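{- Let $A$ be a finite subset of $\mathbb Z_{>0}$, let $m\ge 1$ be an odd integer and $\mathcal R=\{1,3,\dots,m\}\cap A$. For all $\pi\in\Pi_{\Gamma_A^{\mathcal R}}$, $$(-1)^{|\pi|}\mu_{\Pi_{\Gamma_A^{\mathcal R}}}(\hat 0,\pi)=\bigl|\{\sigma\in\mathcal D_A^{\mathcal R}:\operatorname{cyc}(\sigma)=\pi\}\bigr|.$$ Consequently, $$\chi_{\Pi_{\Gamma_A^{\mathcal R}}}(t)=\sum_{k=1}^{|A|}s_{\mathcal RD}(A,k)\,t^{k-1},$$ where $(-1)^{k}s_{\mathcal RD}(A,k)$ is equal to the number of $\mathcal R$-D-permutations on $A$ with exactly $k$ cycles.
   Context: Graph: $\Gamma_A^{\mathcal R}$ is the graph on vertex set $A$ with edge set $\{\{u,v\}:u,v\in A,\ u<v,\ u\text{ odd},\ v\text{ even}\}\cup\{\{u,v\}:u,v\in A,\ u<v\le m,\ u,v\text{ odd}\}$. Bond lattice: for a finite graph $G=(V,E)$, $\Pi_G$ is the poset of set partitions $\pi$ of $V$ such that the induced subgraph of $G$ on each block of $\pi$ is connected, ordered so that $\pi\le\pi'$ iff every block of $\pi$ is contained in a block of $\pi'$. $\hat 0$ is the partition into singletons, $|\pi|$ is the number of blocks of $\pi$, and $\mu_{\Pi_G}$ is the Möbius function of $\Pi_G$. The characteristic polynomial of a finite ranked poset $P$ of length $\ell$ with minimum element $\hat 0$ is $\chi_P(t)=\sum_{x\in P}\mu_P(\hat 0,x)\,t^{\ell-\operatorname{rk}(x)}$,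 where $\operatorname{rk}(x)$ is the rank of $x$. An $\mathcal R$-D-permutation on $A$ is a permutation $\sigma$ of the set $A$ such that $i\le\sigma(i)$ whenever $i\in A$ is odd and $i\notin\mathcal R$, and $i\ge\sigma(i)$ whenever $i\in A$ is even (no condition at $i\in\mathcal R$). $\mathcal D_A^{\mathcal R}$ is the set of $\mathcal R$-D-permutations on $A$. The cycle support $\operatorname{cyc}(\sigma)$ is the set partition of $A$ whose blocks are the element sets of the cycles of $\sigma$ (fixed points give singleton blocks).
   Formalization: The right sides of both formulas carry a factor (-1)^{|A|}, the left side of the second a factor t^{c-1} (c = number of connected components of the graph), and the second assumes A nonempty; as printed they fail, e.g. for A={1}, for A={1,3} with m=1, and for A empty. -}

module Defs where

open import Data.Bool.Base using (Bool; true; false)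
open import Data.Empty using (⊥-elim)
open import Data.Fin.Base using (Fin; zero; suc)
import Data.Fin.Base as Fin
import Data.Fin.Properties as Fin
open import Data.Fin.Induction using (spo-wellFounded)
open import Data.Fin.Subset using (Subset; _∈_; _⊆_; ⁅_⁆)
import Data.Fin.Subset.Properties as Subset
open import Data.Integer.Base using (ℤ; 0ℤ; 1ℤ; -1ℤ; +_; -_)
import Data.Integer.Base as ℤ
open import Data.Irrelevant using ([_])
open import Data.List.Base using (List; []; _∷_; _++_; map; filter; foldr; length; replicate; upTo; deduplicate; cartesianProductWith)
import Data.List.Base as List
import Data.List.Membership.Propositional as List∈
open import Data.List.Membership.Propositional.Properties using (∈-cartesianProductWith⁺; ∈-allFin)
open import Data.List.Relation.Unary.All using (All; []; _∷_)
open import Data.List.Relation.Unary.Any using (here; there; index)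
open import Data.List.Relation.Unary.Any.Properties using (lookup-index)
open import Data.List.Relation.Unary.AllPairs using ([]; _∷_)
open import Data.List.Relation.Unary.Unique.Propositional using (Unique)
import Data.List.Relation.Unary.Unique.Propositional.Properties as Unique
open import Data.Nat.Base using (ℕ; zero; suc; _⊔_; _∸_; _≤_; _<_)
import Data.Nat.Properties as ℕ
open import Data.Nat.Divisibility using (_∣_; _∤_; _∣?_)
open import Data.Product.Base using (_×_; _,_; ∃; proj₁; proj₂)
open import Data.Refinement.Base using (Refinement; Refinement-syntax; value; _,_)
open import Data.Sum.Base using (_⊎_; inj₁; inj₂; swap)
open import Data.Vec.Base using (Vec; []; _∷_; lookup; tabulate; toList)
import Data.Vec.Properties as Vec
import Data.Bool.Properties as Bool
open import Function.Base using (_∘_; _on_; id)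
open import Function.Definitions using (Injective; Surjective; Bijective)
open import Induction.WellFounded using (WellFounded; Acc; acc; module Subrelation)
open import Level using (0ℓ)
open import Relation.Binary.Core using (Rel)
open import Relation.Binary.Definitions using (Decidable; DecidableEquality; Symmetric; Irreflexive)
open import Relation.Binary.Structures using (IsDecPartialOrder; IsStrictPartialOrder)
open import Relation.Binary.Construct.Closure.ReflexiveTransitive using (Star; ε; _◅_; _◅◅_)
import Relation.Binary.Construct.NonStrictToStrict as ToStrict
import Relation.Binary.Construct.On as On
open import Relation.Binary.PropositionalEquality using (_≡_; refl; sym; trans; cong; cong₂; subst; subst₂; isEquivalence)
open import Relation.Nullary using (Dec; yes; no; does; ¬_; ¬?; _×-dec_; _⊎-dec_; _→-dec_)
open import Relation.Nullary.Decidable using (map′; recompute)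
import Relation.Unary as Unary

-- Polynomials in one variable t over ℤ, as lists of coefficients with
-- the constant term first; trailing zeros are not significant.
Poly : Set
Poly = List ℤ

coeff : Poly → ℕ → ℤ
coeff []      _       = 0ℤ
coeff (a ∷ p) zero    = a
coeff (a ∷ p) (suc j) = coeff p j

infix 4 _≈ₚ_
_≈ₚ_ : Rel Poly 0ℓ
p ≈ₚ q = ∀ j → coeff p j ≡ coeff q j

infixl 6 _+ₚ_
_+ₚ_ : Poly → Poly → Poly
[]      +ₚ q       = q
(a ∷ p) +ₚ []      = a ∷ p
(a ∷ p) +ₚ (b ∷ q) = (a ℤ.+ b) ∷ (p +ₚ q)

infixr 7 _·ₚ_
_·ₚ_ : ℤ → Poly → Poly
c ·ₚ p = map (c ℤ.*_) p

-- t^e · p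
shift : ℕ → Poly → Poly
shift e p = replicate e 0ℤ ++ p

monomial : ℤ → ℕ → Poly
monomial a e = shift e (a ∷ [])

sumₚ : List Poly → Poly
sumₚ = foldr _+ₚ_ []

sumℤ : List ℤ → ℤ
sumℤ = foldr ℤ._+_ 0ℤ

sign : ℕ → ℤ
sign k = -1ℤ ℤ.^ k

ifYes : {P B : Set} → B → Dec P → (P → B) → B
ifYes b (yes p) f = f p
ifYes b (no _)  f = b

record FinitePoset : Set₁ where
  infix 4 _≤ᴾ_
  field
    Carrier           : Set
    _≤ᴾ_              : Rel Carrier 0ℓ
    isDecPartialOrder : IsDecPartialOrder _≡_ _≤ᴾ_
    elements          : List Carrier
    complete          : ∀ x → x List∈.∈ elements
    unique            : Unique elements

  open IsDecPartialOrder isDecPartialOrder public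
    using (isPartialOrder) renaming (_≟_ to _≟ᴾ_; _≤?_ to _≤ᴾ?_)
  open ToStrict _≡_ _≤ᴾ_ public using () renaming (_<_ to _<ᴾ_)

  _<ᴾ?_ : Decidable _<ᴾ_
  _<ᴾ?_ = ToStrict.<-decidable _≡_ _≤ᴾ_ _≟ᴾ_ _≤ᴾ?_

  position : Carrier → Fin (length elements)
  position x = index (complete x)

  lookup-position : ∀ x → x ≡ List.lookup elements (position x)
  lookup-position x = lookup-index (complete x)

  <ᴾ-wellFounded : WellFounded _<ᴾ_
  <ᴾ-wellFounded = Subrelation.wellFounded
    (λ {x} {y} → subst₂ _<ᴾ_ (lookup-position x) (lookup-position y))
    (On.wellFounded position (spo-wellFounded isStrict))
    where
    isStrict : IsStrictPartialOrder _≡_ (_<ᴾ_ on List.lookup elements)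
    isStrict = record
      { isEquivalence = isEquivalence
      ; irrefl        = λ { refl (_ , x≢x) → x≢x refl }
      ; trans         = ToStrict.<-trans _≡_ _≤ᴾ_ isPartialOrder
      ; <-resp-≈      = (λ { refl p → p }) , (λ { refl p → p })
      }

  μ-acc : ∀ x y → Acc _<ᴾ_ y → ℤ
  μ-acc x y (acc rs) with x ≟ᴾ y | x ≤ᴾ? y
  ... | yes _ | _     = 1ℤ
  ... | no _  | no _  = 0ℤ
  ... | no _  | yes _ = - sumℤ (map (λ z →
    ifYes 0ℤ (x ≤ᴾ? z ×-dec z <ᴾ? y) (λ p → μ-acc x z (rs (proj₂ p)))) elements)

  rk-acc : ∀ x → Acc _<ᴾ_ x → ℕ
  rk-acc x (acc rs) = foldr _⊔_ 0 (map (λ z →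
    ifYes 0 (z <ᴾ? x) (λ z<x → suc (rk-acc z (rs z<x)))) elements)

  -- μ x x = 1,  μ x y = - Σ { μ x z ∣ x ≤ z < y }  for x < y,  and
  -- μ x y = 0 when x ≰ y.
  μ : Carrier → Carrier → ℤ
  μ x y = μ-acc x y (<ᴾ-wellFounded y)

  -- The length of a longest chain with top element x; in a ranked poset
  -- this is the rank of x.
  rk : Carrier → ℕ
  rk x = rk-acc x (<ᴾ-wellFounded x)

  len : ℕ
  len = foldr _⊔_ 0 (map rk elements)

  -- The argument is the minimum element.
  χ : Carrier → Poly
  χ 0̂ = sumₚ (map (λ x → monomial (μ 0̂ x) (len ∸ rk x)) elements)

vectors : {X : Set} → List X → ∀ n → List (Vec X n)
vectors xs zero    = [] ∷ []
vectors xs (suc n) = cartesianProductWith _∷_ xs (vectors xs n)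

vectors-complete : {X : Set} {xs : List X} → (∀ x → x List∈.∈ xs) →
                   ∀ {n} (v : Vec X n) → v List∈.∈ vectors xs n
vectors-complete c []      = here refl
vectors-complete c (x ∷ v) = ∈-cartesianProductWith⁺ _∷_ (c x) (vectors-complete c v)

vectors-unique : {X : Set} {xs : List X} → Unique xs → ∀ n → Unique (vectors xs n)
vectors-unique u zero    = [] ∷ []
vectors-unique u (suc n) =
  Unique.cartesianProductWith⁺ _∷_ Vec.∷-injective u (vectors-unique u n)

module _ {X : Set} {P : X → Set} (P? : Unary.Decidable P) where

  restrict : List X → List [ x ∈ X ∣ P x ]
  restrict []       = []
  restrict (x ∷ xs) with P? x
  ... | yes p = (x , [ p ]) ∷ restrict xs
  ... | no _  = restrict xs

  restrict-complete : ∀ {xs} (y : [ x ∈ X ∣ P x ]) → value y List∈.∈ xs →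
                      y List∈.∈ restrict xs
  restrict-complete {x ∷ xs} (y , [ p ]) (here refl) with P? x
  ... | yes _ = here refl
  ... | no ¬p = ⊥-elim (¬p (recompute (P? x) p))
  restrict-complete {x ∷ xs} y (there i) with P? x
  ... | yes _ = there (restrict-complete y i)
  ... | no _  = restrict-complete y i

  restrict-fresh : ∀ {x} {p} {xs} → All (λ z → ¬ x ≡ z) xs →
                   All (λ z → ¬ (x , p) ≡ z) (restrict xs)
  restrict-fresh {xs = []}     []       = []
  restrict-fresh {xs = z ∷ xs} (n ∷ ns) with P? z
  ... | yes _ = (λ e → n (cong value e)) ∷ restrict-fresh ns
  ... | no _  = restrict-fresh ns

  restrict-unique : ∀ {xs} → Unique xs → Unique (restrict xs)
  restrict-unique {[]}     []      = []
  restrict-unique {x ∷ xs} (n ∷ u) with P? x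
  ... | yes _ = restrict-fresh n ∷ restrict-unique u
  ... | no _  = restrict-unique u

module Reachability {n : ℕ} {R : Rel (Fin n) 0ℓ} (R? : Decidable R) where

  -- A path whose inner vertices are taken from the list.
  Via : List (Fin n) → Rel (Fin n) 0ℓ
  Via []       u v = u ≡ v ⊎ R u v
  Via (w ∷ ws) u v = Via ws u v ⊎ (Via ws u w × Via ws w v)

  via? : ∀ ws → Decidable (Via ws)
  via? []       u v = (u Fin.≟ v) ⊎-dec R? u v
  via? (w ∷ ws) u v = via? ws u v ⊎-dec (via? ws u w ×-dec via? ws w v)

  via⇒star : ∀ ws {u v} → Via ws u v → Star R u v
  via⇒star []       (inj₁ refl)    = ε
  via⇒star []       (inj₂ r)       = r ◅ ε
  via⇒star (w ∷ ws) (inj₁ p)       = via⇒star ws p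
  via⇒star (w ∷ ws) (inj₂ (p , q)) = via⇒star ws p ◅◅ via⇒star ws q

  base⇒via : ∀ ws {u v} → u ≡ v ⊎ R u v → Via ws u v
  base⇒via []       r = r
  base⇒via (w ∷ ws) r = inj₁ (base⇒via ws r)

  via-head : ∀ ws {u w} → Via (w ∷ ws) u w → Via ws u w
  via-head ws (inj₁ p)       = p
  via-head ws (inj₂ (p , _)) = p

  via-last : ∀ ws {w v} → Via (w ∷ ws) w v → Via ws w v
  via-last ws (inj₁ p)       = p
  via-last ws (inj₂ (_ , q)) = q

  via-trans : ∀ {ws u w v} → w List∈.∈ ws → Via ws u w → Via ws w v → Via ws u v
  via-trans {x ∷ ws} (here refl) p q = inj₂ (via-head ws p , via-last ws q)
  via-trans {x ∷ ws} (there i) (inj₁ p)        (inj₁ q)        = inj₁ (via-trans i p q)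
  via-trans {x ∷ ws} (there i) (inj₁ p)        (inj₂ (q , q′)) = inj₂ (via-trans i p q , q′)
  via-trans {x ∷ ws} (there i) (inj₂ (p , p′)) (inj₁ q)        = inj₂ (p , via-trans i p′ q)
  via-trans {x ∷ ws} (there i) (inj₂ (p , _))  (inj₂ (_ , q′)) = inj₂ (p , q′)

  star⇒via : ∀ {u v} → Star R u v → Via (List.allFin n) u v
  star⇒via ε            = base⇒via (List.allFin n) (inj₁ refl)
  star⇒via (_◅_ {j = w} r rs) =
    via-trans (∈-allFin w) (base⇒via (List.allFin n) (inj₂ r)) (star⇒via rs)

  star? : Decidable (Star R)
  star? u v = map′ (via⇒star _) star⇒via (via? (List.allFin n) u v)

open Reachability public using (star?)

-- A set partition is stored as the table sending each element to the
-- block containing it, so a block occurs once for each of its elements.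
Table : ℕ → Set
Table n = Vec (Subset n) n

IsPartition : ∀ {n} → Table n → Set
IsPartition τ = (∀ i → i ∈ lookup τ i) ×
                (∀ i j → j ∈ lookup τ i → lookup τ j ≡ lookup τ i)

infix 4 _≟ˢ_ _≟ᵀ_
_≟ˢ_ : ∀ {n} → DecidableEquality (Subset n)
_≟ˢ_ = Vec.≡-dec Bool._≟_

_≟ᵀ_ : ∀ {n} → DecidableEquality (Table n)
_≟ᵀ_ = Vec.≡-dec _≟ˢ_

isPartition? : ∀ {n} → Unary.Decidable (IsPartition {n})
isPartition? τ =
  Fin.all? (λ i → i Subset.∈? lookup τ i) ×-dec
  Fin.all? (λ i → Fin.all? (λ j →
    (j Subset.∈? lookup τ i) →-dec (lookup τ j ≟ˢ lookup τ i)))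

numBlocks : ∀ {n} → Table n → ℕ
numBlocks τ = length (deduplicate _≟ˢ_ (toList τ))

-- Every block of σ is contained in a block of τ.
infix 4 _≤ᵀ_
_≤ᵀ_ : ∀ {n} → Rel (Table n) 0ℓ
σ ≤ᵀ τ = ∀ i → ∃ λ j → lookup σ i ⊆ lookup τ j

_≤ᵀ?_ : ∀ {n} → Decidable (_≤ᵀ_ {n})
σ ≤ᵀ? τ = Fin.all? (λ i → Fin.any? (λ j → lookup σ i Subset.⊆? lookup τ j))

≤ᵀ-antisym : ∀ {n} {σ τ : Table n} → IsPartition σ → IsPartition τ →
             σ ≤ᵀ τ → τ ≤ᵀ σ → σ ≡ τ
≤ᵀ-antisym {σ = σ} {τ} pσ pτ σ≤τ τ≤σ =
  trans (sym (Vec.tabulate∘lookup σ))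
    (trans (Vec.tabulate-cong (λ i → Subset.⊆-antisym
             (block⊆ σ τ pσ pτ σ≤τ i) (block⊆ τ σ pτ pσ τ≤σ i)))
           (Vec.tabulate∘lookup τ))
  where
  block⊆ : ∀ σ τ → IsPartition σ → IsPartition τ → σ ≤ᵀ τ →
           ∀ i → lookup σ i ⊆ lookup τ i
  block⊆ σ τ (r , _) (_ , s) le i with le i
  ... | j , ⊆j = λ x∈ → subst (_ ∈_) (sym (s j i (⊆j (r i)))) (⊆j x∈)

-- The i-th entry is the set of elements reachable from i.
reachTable : ∀ {n} {R : Rel (Fin n) 0ℓ} → Decidable R → Table n
reachTable R? = tabulate (λ i → tabulate (λ j → does (star? R? i j)))

record Graph (n : ℕ) : Set₁ where
  infix 4 _~_
  field
    _~_      : Rel (Fin n) 0ℓ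
    _~?_     : Decidable _~_
    ~-sym    : Symmetric _~_
    ~-irrefl : Irreflexive _≡_ _~_

module _ {n : ℕ} (G : Graph n) where
  open Graph G

  Induced : Subset n → Rel (Fin n) 0ℓ
  Induced B u v = u ∈ B × v ∈ B × u ~ v

  induced? : ∀ B → Decidable (Induced B)
  induced? B u v = (u Subset.∈? B) ×-dec (v Subset.∈? B) ×-dec (u ~? v)

  Connected : Subset n → Set
  Connected B = ∀ u v → u ∈ B → v ∈ B → Star (Induced B) u v

  connected? : Unary.Decidable Connected
  connected? B = Fin.all? (λ u → Fin.all? (λ v →
    (u Subset.∈? B) →-dec ((v Subset.∈? B) →-dec star? (induced? B) u v)))

  numComponents : ℕ
  numComponents = numBlocks (reachTable _~?_)

  IsBond : Table n → Set
  IsBond τ = IsPartition τ × (∀ i → Connected (lookup τ i))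

  isBond? : Unary.Decidable IsBond
  isBond? τ = isPartition? τ ×-dec Fin.all? (λ i → connected? (lookup τ i))

  Bond : Set
  Bond = [ τ ∈ Table n ∣ IsBond τ ]

  bonds : List Bond
  bonds = restrict isBond? (vectors (vectors (true ∷ false ∷ []) n) n)

  bondLattice : FinitePoset
  bondLattice = record
    { Carrier           = Bond
    ; _≤ᴾ_              = _≤ᵀ_ on value
    ; isDecPartialOrder = record
      { isPartialOrder = record
        { isPreorder = record
          { isEquivalence = isEquivalence
          ; reflexive     = λ { refl i → i , id }
          ; trans         = λ p q i →
              proj₁ (q (proj₁ (p i))) , proj₂ (q (proj₁ (p i))) ∘ proj₂ (p i)
          }
        ; antisym = antisym
        }
      ; _≟_  = λ { (σ , _) (τ , _) → map′ (λ { refl → refl }) (cong value) (σ ≟ᵀ τ) }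
      ; _≤?_ = λ σ τ → value σ ≤ᵀ? value τ
      }
    ; elements          = bonds
    ; complete          = λ π → restrict-complete isBond? π
                            (vectors-complete (vectors-complete bool-complete) (value π))
    ; unique            = restrict-unique isBond?
                            (vectors-unique (vectors-unique bool-unique n) n)
    }
    where
    bool-complete : ∀ b → b List∈.∈ (true ∷ false ∷ [])
    bool-complete true  = here refl
    bool-complete false = there (here refl)

    bool-unique : Unique (true ∷ false ∷ [])
    bool-unique = ((λ ()) ∷ []) ∷ [] ∷ []

    antisym : {σ τ : Bond} → value σ ≤ᵀ value τ → value τ ≤ᵀ value σ → σ ≡ τ
    antisym {σ , [ p ]} {τ , [ q ]} σ≤τ τ≤σ
      with refl ← ≤ᵀ-antisym {σ = σ} {τ} (recompute (isPartition? σ) (proj₁ p))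
                             (recompute (isPartition? τ) (proj₁ q)) σ≤τ τ≤σ = refl

  singletons : Table n
  singletons = tabulate ⁅_⁆

  lookup-singletons : ∀ i → lookup singletons i ≡ ⁅ i ⁆
  lookup-singletons = Vec.lookup∘tabulate ⁅_⁆

  ∈-singletons : ∀ {i j} → j ∈ lookup singletons i → j ≡ i
  ∈-singletons {i} {j} p = Subset.x∈⁅y⁆⇒x≡y i (subst (j ∈_) (lookup-singletons i) p)

  singletons-isBond : IsBond singletons
  singletons-isBond =
    ( (λ i → subst (i ∈_) (sym (lookup-singletons i)) (Subset.x∈⁅x⁆ i))
    , (λ i j p → cong (lookup singletons) (∈-singletons p)) )
    , λ i u v p q → subst (Star _ u) (trans (∈-singletons p) (sym (∈-singletons q))) ε

  0̂ : Bond
  0̂ = singletons , [ singletons-isBond ]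

-- Finite subsets A of ℤ_{>0}, listed in increasing order. Graphs,
-- partitions and permutations on A are taken on the index set Fin size.
record FiniteSubset : Set where
  field
    size       : ℕ
    element    : Fin size → ℕ
    positive   : ∀ i → 0 < element i
    increasing : ∀ {i j} → i Fin.< j → element i < element j

Odd Even : ℕ → Set
Odd k  = 2 ∤ k
Even k = 2 ∣ k

-- For k ∈ A this says k ∈ 𝓡 = {1, 3, …, m} ∩ A.
InR : ℕ → ℕ → Set
InR m k = Odd k × k ≤ m

odd? : Unary.Decidable Odd
odd? k = ¬? (2 ∣? k)

inR? : ∀ m → Unary.Decidable (InR m)
inR? m k = odd? k ×-dec k ℕ.≤? m

Arc : ℕ → Rel ℕ 0ℓ
Arc m u v = (u < v × Odd u × Even v) ⊎ (u < v × v ≤ m × Odd u × Odd v)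

arc? : ∀ m → Decidable (Arc m)
arc? m u v = (u ℕ.<? v ×-dec odd? u ×-dec 2 ∣? v)
      ⊎-dec (u ℕ.<? v ×-dec v ℕ.≤? m ×-dec odd? u ×-dec odd? v)

module _ (A : FiniteSubset) (m : ℕ) where
  open FiniteSubset A

  Γ : Graph size
  Γ = record
    { _~_      = λ i j → Arc m (element i) (element j) ⊎ Arc m (element j) (element i)
    ; _~?_     = λ i j → arc? m (element i) (element j) ⊎-dec arc? m (element j) (element i)
    ; ~-sym    = swap
    ; ~-irrefl = λ { refl (inj₁ a) → arc-irrefl a ; refl (inj₂ a) → arc-irrefl a }
    }
    where
    arc-irrefl : ∀ {k} → ¬ Arc m k k
    arc-irrefl (inj₁ (k<k , _)) = ℕ.<-irrefl refl k<k
    arc-irrefl (inj₂ (k<k , _)) = ℕ.<-irrefl refl k<k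

  -- A map σ : A → A is stored as the vector of its values.
  IsDPermutation : Vec (Fin size) size → Set
  IsDPermutation σ =
    Bijective _≡_ _≡_ (lookup σ) ×
    (∀ i → Odd (element i) → ¬ InR m (element i) → element i ≤ element (lookup σ i)) ×
    (∀ i → Even (element i) → element (lookup σ i) ≤ element i)

  isDPermutation? : Unary.Decidable IsDPermutation
  isDPermutation? σ = (injective? ×-dec surjective?) ×-dec
    Fin.all? (λ i → odd? (element i) →-dec (¬? (inR? m (element i)) →-dec
      (element i ℕ.≤? element (lookup σ i)))) ×-dec
    Fin.all? (λ i → (2 ∣? element i) →-dec (element (lookup σ i) ℕ.≤? element i))
    where
    injective? : Dec (Injective _≡_ _≡_ (lookup σ))
    injective? = map′ (λ f {x} {y} → f x y) (λ f x y → f)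
      (Fin.all? (λ x → Fin.all? (λ y →
        (lookup σ x Fin.≟ lookup σ y) →-dec (x Fin.≟ y))))

    surjective? : Dec (Surjective _≡_ _≡_ (lookup σ))
    surjective? = map′
      (λ f y → proj₁ (f y) , λ { refl → proj₂ (f y) })
      (λ f y → proj₁ (f y) , proj₂ (f y) refl)
      (Fin.all? (λ y → Fin.any? (λ x → lookup σ x Fin.≟ y)))

  DPermutation : Set
  DPermutation = [ σ ∈ Vec (Fin size) size ∣ IsDPermutation σ ]

  dPermutations : List DPermutation
  dPermutations = restrict isDPermutation? (vectors (List.allFin size) size)

  -- The block of i is {i, σ i, σ (σ i), …}.
  cyc : DPermutation → Table size
  cyc (σ , _) = reachTable (λ i j → lookup σ i Fin.≟ j)

  numWithSupport : Table size → ℕ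
  numWithSupport π = length (filter (λ σ → cyc σ ≟ᵀ π) dPermutations)

  numWithCycles : ℕ → ℕ
  numWithCycles k = length (filter (λ σ → numBlocks (cyc σ) ℕ.≟ k) dPermutations)

  -- s(A,k): (-1)^k s(A,k) is the number of permutations with k cycles.
  s : ℕ → ℤ
  s k = sign k ℤ.* + numWithCycles k

  -- Σ_{k=1}^{|A|} s(A,k) t^{k-1}
  cyclePolynomial : Poly
  cyclePolynomial = sumₚ (map (λ j → monomial (s (suc j)) j) (upTo size))

module Submission where

-- The Möbius recursion is verified for the signed counts: as the cycle
-- support of a D-permutation is a bond, the sum over all z ≤ π becomes
-- the sum of the signs of the D-permutations that preserve every block
-- of π.  A block B of π with at least two elements is connected, so its
-- minimum a is odd and its maximum b is even or in R; hence neither a nor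
-- b restricts the image inside B, and σ ↦ σ ∘ (a b) is an involution that
-- changes the number of cycles by one, so that the sum vanishes.
-- For χ, merging two adjacent blocks inside a block of a coarser bond
-- shows that the rank of π is |A| - |π|.

open import Defs
open import Data.Bool.Base using (true; false; if_then_else_)
open import Data.Empty using (⊥-elim)
open import Data.Fin.Base using (Fin; zero; suc; toℕ)
import Data.Fin.Base as Fin
open import Data.Fin.Permutation.Components using (transpose)
import Data.Fin.Properties as Fin
open import Data.Fin.Subset using (Subset; _∈_; _∉_; _⊆_; _∪_; ⁅_⁆)
import Data.Fin.Subset.Properties as Subset
open import Data.Integer.Base using (ℤ; 0ℤ; 1ℤ; -1ℤ; +_; -_; _+_; _*_)
import Data.Integer.Properties as ℤ
open import Data.Integer.Tactic.RingSolver using (solve-∀)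
open import Data.Irrelevant using ([_])
open import Data.List.Base using (List; []; _∷_; map; filter; foldr; length; deduplicate; allFin; upTo)
import Data.List.Membership.Propositional as List∈
open import Data.List.Membership.Propositional.Properties using (∈-map⁺; ∈-map⁻; ∈-filter⁺; ∈-filter⁻; ∈-deduplicate⁺; ∈-deduplicate⁻; ∈-allFin; ∈-upTo⁺)
open import Data.List.Membership.Propositional.Properties.WithK using (unique∧set⇒bag)
open import Data.List.Properties using (map-cong; map-∘; length-map; length-tabulate)
open import Data.List.Relation.Binary.BagAndSetEquality using (∼bag⇒↭)
open import Data.List.Relation.Binary.Permutation.Propositional using (_↭_)
import Data.List.Relation.Binary.Permutation.Propositional as ↭
open import Data.List.Relation.Binary.Permutation.Propositional.Properties using (↭-length)
open import Data.List.Relation.Unary.All using (All; []; _∷_)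
import Data.List.Relation.Unary.All as All
open import Data.List.Relation.Unary.AllPairs using ([]; _∷_)
open import Data.List.Relation.Unary.Any using (here; there)
open import Data.List.Relation.Unary.Unique.DecPropositional.Properties using (deduplicate-!)
open import Data.List.Relation.Unary.Unique.Propositional using (Unique)
import Data.List.Relation.Unary.Unique.Propositional.Properties as Unique
open import Data.Nat.Base using (ℕ; zero; suc; _≤_; _<_; _⊔_; _∸_; s≤s; z≤n)
import Data.Nat.Base as ℕ
open import Data.Nat.Divisibility using (_∣?_)
open import Data.Nat.GeneralisedArithmetic using (fold)
import Data.Nat.Properties as ℕ
open import Data.Product.Base using (_×_; _,_; ∃; proj₁; proj₂)
import Data.Product.Base as Product
open import Data.Refinement.Base using (value; _,_)
open import Data.Sum.Base using (_⊎_; inj₁; inj₂)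
import Data.Sum.Base as Sum
open import Data.Vec.Base using (Vec; _∷_; lookup; tabulate; toList)
import Data.Vec.Membership.Propositional.Properties as Vec∈
import Data.Vec.Properties as Vec
import Data.Vec.Relation.Unary.Any as VecAny
import Data.Vec.Relation.Unary.Any.Properties as VecAny
open import Function.Base using (_∘_; id)
open import Function.Bundles using (mk⇔)
open import Function.Definitions using (Injective; Surjective)
open import Induction.WellFounded using (Acc; acc)
open import Level using (0ℓ)
open import Relation.Binary.Construct.Closure.ReflexiveTransitive using (Star; ε; _◅_; _◅◅_; _⋆; gmap; reverse)
open import Relation.Binary.Core using (Rel)
open import Relation.Binary.Definitions using (Decidable; Symmetric; Tri; tri<; tri≈; tri>)
open import Relation.Binary.PropositionalEquality using (_≡_; _≢_; refl; sym; trans; cong; cong₂; subst; module ≡-Reasoning)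
open import Relation.Binary.Structures using (IsPartialOrder)
open import Relation.Nullary using (Dec; yes; no; does; ¬_; ¬?; _×-dec_)
open import Relation.Nullary.Decidable using (dec-true; dec-false; decidable-stable; recompute)
import Relation.Unary as Unary

-- The involution is the classical argument that a matrix with two equal rows has determinant zero.
-- Since (-1)^(number of cycles) is, up to the constant (-1)^|A|, the signature, the signed sum
-- below π is up to sign a product over the blocks of determinants of 0-1 matrices of admissible
-- pairs (i, σ i). In a block with at least two elements the rows of its minimum and of its maximum
-- consist of ones only. Two normalisations shape the final statement. At π = `0̂` the Möbius value
-- and the count are both 1 while |π| = |A|, so the signed identity must carry the factor
-- `sign (size A)`. If the graph has c components, the lattice has length |A| - c, so π contributes
-- to the power |π| - c of t in χ, whereas the cycle polynomial uses |π| - 1; this is the origin of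
-- the shift by c - 1.

private variable
  X Y : Set
  n : ℕ

-- Finite sums of integers and indicators

∑ : List X → (X → ℤ) → ℤ
∑ xs f = sumℤ (map f xs)

∑-cong : ∀ {f g : X → ℤ} xs → (∀ x → f x ≡ g x) → ∑ xs f ≡ ∑ xs g
∑-cong xs f≗g = cong sumℤ (map-cong f≗g xs)

∑-zero : ∀ {f : X → ℤ} xs → (∀ x → f x ≡ 0ℤ) → ∑ xs f ≡ 0ℤ
∑-zero []       f≗0 = refl
∑-zero (x ∷ xs) f≗0 = cong₂ _+_ (f≗0 x) (∑-zero xs f≗0)

∑-+ : ∀ (f g : X → ℤ) xs → ∑ xs (λ x → f x + g x) ≡ ∑ xs f + ∑ xs g
∑-+ f g []       = refl
∑-+ f g (x ∷ xs) =
  trans (cong (_+_ (f x + g x)) (∑-+ f g xs)) (medial (f x) (g x) (∑ xs f) (∑ xs g))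
  where
  medial : ∀ a b c d → (a + b) + (c + d) ≡ (a + c) + (b + d)
  medial = solve-∀

*-∑ : ∀ c (f : X → ℤ) xs → c * ∑ xs f ≡ ∑ xs (λ x → c * f x)
*-∑ c f []       = ℤ.*-zeroʳ c
*-∑ c f (x ∷ xs) = trans (ℤ.*-distribˡ-+ c (f x) (∑ xs f)) (cong (_+_ (c * f x)) (*-∑ c f xs))

neg-∑ : ∀ (f : X → ℤ) xs → - ∑ xs f ≡ ∑ xs (λ x → - f x)
neg-∑ f []       = refl
neg-∑ f (x ∷ xs) = trans (ℤ.neg-distrib-+ (f x) (∑ xs f)) (cong (_+_ (- f x)) (neg-∑ f xs))

∑-swap : ∀ (f : X → Y → ℤ) xs ys →
         ∑ xs (λ x → ∑ ys (f x)) ≡ ∑ ys (λ y → ∑ xs (λ x → f x y))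
∑-swap f []       ys = sym (∑-zero ys (λ _ → refl))
∑-swap f (x ∷ xs) ys = trans (cong (_+_ (∑ ys (f x))) (∑-swap f xs ys))
                             (sym (∑-+ (f x) (λ y → ∑ xs (λ x → f x y)) ys))

∑-↭ : ∀ (f : X → ℤ) {xs ys} → xs ↭ ys → ∑ xs f ≡ ∑ ys f
∑-↭ f ↭.refl         = refl
∑-↭ f (↭.prep x p)     = cong (_+_ (f x)) (∑-↭ f p)
∑-↭ f (↭.swap x y p)   = trans (cong (λ s → f x + (f y + s)) (∑-↭ f p)) (exchange (f x) (f y) _)
  where
  exchange : ∀ a b c → a + (b + c) ≡ b + (a + c)
  exchange = solve-∀
∑-↭ f (↭.trans p q)  = trans (∑-↭ f p) (∑-↭ f q)

∑-single : ∀ (f : X → ℤ) {x xs} → Unique xs → x List∈.∈ xs →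
           (∀ y → y ≢ x → f y ≡ 0ℤ) → ∑ xs f ≡ f x
∑-single f {x} (x∉ ∷ _) (here refl) f≡0 =
  trans (cong (_+_ (f x)) (rest x∉)) (ℤ.+-identityʳ (f x))
  where
  rest : ∀ {ys} → All (λ y → x ≢ y) ys → ∑ ys f ≡ 0ℤ
  rest []       = refl
  rest (n ∷ ns) = cong₂ _+_ (f≡0 _ (n ∘ sym)) (rest ns)
∑-single f (y∉ ∷ u) (there x∈) f≡0 =
  trans (cong₂ _+_ (f≡0 _ (All.lookup y∉ x∈)) (∑-single f u x∈ f≡0)) (ℤ.+-identityˡ _)

-- Lists without repetition are determined up to order by their members. Both the reindexing of sums
-- and the comparison of block counts rest on this.
unique∧⊆∧⊇⇒↭ : ∀ {xs ys : List X} → Unique xs → Unique ys →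
               (∀ {x} → x List∈.∈ xs → x List∈.∈ ys) → (∀ {x} → x List∈.∈ ys → x List∈.∈ xs) → xs ↭ ys
unique∧⊆∧⊇⇒↭ u v p q = ∼bag⇒↭ (unique∧set⇒bag u v (mk⇔ p q))

i≡-i⇒i≡0 : ∀ i → i ≡ - i → i ≡ 0ℤ
i≡-i⇒i≡0 (+ zero) _ = refl

-- Reindexing along φ gives S = - S, and ℤ has no 2-torsion. Fixed points of φ need no separate
-- treatment, since f vanishes at them for the same reason.
∑-involution : ∀ {xs : List X} → Unique xs → (∀ x → x List∈.∈ xs) → (φ : X → X) →
               (∀ x → φ (φ x) ≡ x) → (f : X → ℤ) → (∀ x → f (φ x) ≡ - f x) →
               ∑ xs f ≡ 0ℤ
∑-involution {xs = xs} u c φ φφ f anti = i≡-i⇒i≡0 (∑ xs f) (begin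
  ∑ xs f                ≡⟨ ∑-↭ f xs↭ ⟩
  ∑ (map φ xs) f        ≡⟨ cong sumℤ (sym (map-∘ xs)) ⟩
  ∑ xs (f ∘ φ)          ≡⟨ ∑-cong xs anti ⟩
  ∑ xs (λ x → - f x)    ≡⟨ sym (neg-∑ f xs) ⟩
  - ∑ xs f              ∎)
  where
  open ≡-Reasoning
  xs↭ : xs ↭ map φ xs
  xs↭ = unique∧⊆∧⊇⇒↭ u
    (Unique.map⁺ (λ {x} {y} e → trans (sym (φφ x)) (trans (cong φ e) (φφ y))) u)
    (λ {x} _ → subst (List∈._∈ map φ xs) (φφ x) (∈-map⁺ φ (c (φ x))))
    (λ {x} _ → c x)

𝟙 : ∀ {P : Set} → Dec P → ℤ
𝟙 (yes _) = 1ℤ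
𝟙 (no _)  = 0ℤ

𝟙-yes : ∀ {P : Set} (P? : Dec P) → P → 𝟙 P? ≡ 1ℤ
𝟙-yes (yes _) _ = refl
𝟙-yes (no ¬p) p = ⊥-elim (¬p p)

𝟙-no : ∀ {P : Set} (P? : Dec P) → ¬ P → 𝟙 P? ≡ 0ℤ
𝟙-no (yes p) ¬p = ⊥-elim (¬p p)
𝟙-no (no _)  _  = refl

𝟙-× : ∀ {P Q : Set} (P? : Dec P) (Q? : Dec Q) → 𝟙 (P? ×-dec Q?) ≡ 𝟙 P? * 𝟙 Q?
𝟙-× (yes _) (yes _) = refl
𝟙-× (yes _) (no _)  = refl
𝟙-× (no _)  _       = refl

𝟙-cong : ∀ {P Q : Set} (P? : Dec P) (Q? : Dec Q) → (P → Q) → (Q → P) → 𝟙 P? ≡ 𝟙 Q?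
𝟙-cong P? (yes q) _ g = 𝟙-yes P? (g q)
𝟙-cong P? (no ¬q) f _ = 𝟙-no P? (¬q ∘ f)

length-filter : ∀ {P : X → Set} (P? : Unary.Decidable P) xs →
                + length (filter P? xs) ≡ ∑ xs (𝟙 ∘ P?)
length-filter P? [] = refl
length-filter P? (x ∷ xs) with P? x
... | yes _ = cong (_+_ 1ℤ) (length-filter P? xs)
... | no _  = trans (length-filter P? xs) (sym (ℤ.+-identityˡ _))

-- Carries a sum over D-permutations to one over all maps, where two values can be exchanged without
-- a proof of admissibility at hand.
∑-restrict : ∀ {P : X → Set} (P? : Unary.Decidable P) (f : X → ℤ) xs →
             ∑ (restrict P? xs) (f ∘ value) ≡ ∑ xs (λ x → 𝟙 (P? x) * f x)
∑-restrict P? f [] = refl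
∑-restrict P? f (x ∷ xs) with P? x
... | yes _ = cong₂ _+_ (sym (ℤ.*-identityˡ (f x))) (∑-restrict P? f xs)
... | no _  = trans (∑-restrict P? f xs) (sym (ℤ.+-identityˡ _))

-- Set partitions

lookup-ext : ∀ {X : Set} {v w : Vec X n} → (∀ i → lookup v i ≡ lookup w i) → v ≡ w
lookup-ext {v = v} {w} v≗w =
  trans (sym (Vec.tabulate∘lookup v)) (trans (Vec.tabulate-cong v≗w) (Vec.tabulate∘lookup w))

module _ {R : Rel (Fin n) 0ℓ} (R? : Decidable R) where

  private
    lookup-reachTable : ∀ i j → lookup (lookup (reachTable R?) i) j ≡ does (star? R? i j)
    lookup-reachTable i j =
      trans (cong (λ B → lookup B j) (Vec.lookup∘tabulate _ i)) (Vec.lookup∘tabulate _ j)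

  ∈-reachTable⁺ : ∀ {i j} → Star R i j → j ∈ lookup (reachTable R?) i
  ∈-reachTable⁺ {i} {j} p =
    Vec.lookup⇒[]= j _ (trans (lookup-reachTable i j) (dec-true (star? R? i j) p))

  ∈-reachTable⁻ : ∀ {i j} → j ∈ lookup (reachTable R?) i → Star R i j
  ∈-reachTable⁻ {i} {j} j∈ = decidable-stable (star? R? i j) λ ¬p →
    true≢false (trans (sym (Vec.[]=⇒lookup j∈))
                      (trans (lookup-reachTable i j) (dec-false (star? R? i j) ¬p)))
    where
    true≢false : true ≢ false
    true≢false ()

  reachTable-isPartition : Symmetric (Star R) → IsPartition (reachTable R?)
  reachTable-isPartition symm =
    (λ i → ∈-reachTable⁺ ε) ,
    (λ i j j∈ → let p = ∈-reachTable⁻ j∈ in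
      Subset.⊆-antisym (λ k∈ → ∈-reachTable⁺ (p ◅◅ ∈-reachTable⁻ k∈))
                       (λ k∈ → ∈-reachTable⁺ (symm p ◅◅ ∈-reachTable⁻ k∈)))

module _ {τ : Table n} (pτ : IsPartition τ) where

  ∈-block-sym : ∀ {i j} → j ∈ lookup τ i → i ∈ lookup τ j
  ∈-block-sym {i} {j} j∈ = subst (i ∈_) (sym (proj₂ pτ i j j∈)) (proj₁ pτ i)

  ∈-block-trans : ∀ {i j k} → j ∈ lookup τ i → k ∈ lookup τ j → k ∈ lookup τ i
  ∈-block-trans {i} {j} {k} j∈ = subst (k ∈_) (proj₂ pτ i j j∈)

≤ᵀ⇒⊆ : ∀ {σ τ : Table n} → IsPartition σ → IsPartition τ → σ ≤ᵀ τ →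
       ∀ i → lookup σ i ⊆ lookup τ i
≤ᵀ⇒⊆ (r , _) (_ , s) σ≤τ i with σ≤τ i
... | j , ⊆j = λ x∈ → subst (_ ∈_) (sym (s j i (⊆j (r i)))) (⊆j x∈)

blocks : Table n → List (Subset n)
blocks τ = deduplicate _≟ˢ_ (toList τ)

blocks-! : (τ : Table n) → Unique (blocks τ)
blocks-! τ = deduplicate-! _≟ˢ_ (toList τ)

∈-blocks⁺ : ∀ (τ : Table n) i → lookup τ i List∈.∈ blocks τ
∈-blocks⁺ τ i = ∈-deduplicate⁺ _≟ˢ_ (Vec∈.∈-toList⁺ (Vec∈.∈-lookup i τ))

∈-blocks⁻ : ∀ (τ : Table n) {B} → B List∈.∈ blocks τ → ∃ λ i → B ≡ lookup τ i
∈-blocks⁻ τ B∈ = VecAny.index B∈τ , VecAny.lookup-index B∈τ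
  where B∈τ = Vec∈.∈-toList⁻ (∈-deduplicate⁻ _≟ˢ_ (toList τ) B∈)

numBlocks>0 : (τ : Table n) → 0 < n → 0 < numBlocks τ
numBlocks>0 (_ ∷ _) _ = s≤s z≤n

numBlocks-singletons : numBlocks (tabulate {n = n} ⁅_⁆) ≡ n
numBlocks-singletons {n} = begin
  length (blocks (tabulate {n = n} ⁅_⁆))  ≡⟨ ↭-length (unique∧⊆∧⊇⇒↭ (blocks-! (tabulate ⁅_⁆)) uniq to from) ⟩
  length (map ⁅_⁆ (allFin n))     ≡⟨ length-map ⁅_⁆ (allFin n) ⟩
  length (allFin n)               ≡⟨ length-tabulate (λ i → i) ⟩
  n                               ∎
  where
  open ≡-Reasoning
  uniq : Unique (map (⁅_⁆ {n}) (allFin n))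
  uniq = Unique.map⁺ (λ {x} e → Subset.x∈⁅y⁆⇒x≡y _ (subst (x ∈_) e (Subset.x∈⁅x⁆ x)))
                     (Unique.allFin⁺ n)
  to : ∀ {B} → B List∈.∈ blocks (tabulate ⁅_⁆) → B List∈.∈ map ⁅_⁆ (allFin n)
  to B∈ with i , refl ← ∈-blocks⁻ (tabulate ⁅_⁆) B∈ =
    subst (List∈._∈ _) (sym (Vec.lookup∘tabulate ⁅_⁆ i)) (∈-map⁺ ⁅_⁆ (∈-allFin i))
  from : ∀ {B} → B List∈.∈ map ⁅_⁆ (allFin n) → B List∈.∈ blocks (tabulate ⁅_⁆)
  from B∈ with i , _ , refl ← ∈-map⁻ ⁅_⁆ B∈ =
    subst (List∈._∈ _) (Vec.lookup∘tabulate ⁅_⁆ i) (∈-blocks⁺ (tabulate ⁅_⁆) i)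

infix 4 _∈⟨_∣_⟩
_∈⟨_∣_⟩ : Fin n → Subset n → Subset n → Set
k ∈⟨ B ∣ C ⟩ = k ∈ B ⊎ k ∈ C

-- A relation between two given tables rather than a construction, because it has to fit two
-- situations: orbit tables, which arise from reachability, and explicitly united blocks of a bond.
record IsMerge (τ τ′ : Table n) (a b : Fin n) : Set where
  field
    coarser : ∀ {i} → lookup τ i ⊆ lookup τ′ i
    joined  : b ∈ lookup τ′ a
    minimal : ∀ {i j} → j ∈ lookup τ′ i → j ∈ lookup τ i ⊎
              (i ∈⟨ lookup τ a ∣ lookup τ b ⟩ × j ∈⟨ lookup τ a ∣ lookup τ b ⟩)

module _ {τ τ′ : Table n} {a b} (pτ : IsPartition τ) (pτ′ : IsPartition τ′)
         (b∉ : b ∉ lookup τ a) (mg : IsMerge τ τ′ a b) where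
  open IsMerge mg

  private
    Other : Subset n → Set
    Other B = B ≢ lookup τ a × B ≢ lookup τ b

    other? : ∀ B → Dec (Other B)
    other? B = ¬? (B ≟ˢ lookup τ a) ×-dec ¬? (B ≟ˢ lookup τ b)

    others : List (Subset n)
    others = filter other? (blocks τ)

    inside : ∀ {k} → k ∈⟨ lookup τ a ∣ lookup τ b ⟩ → lookup τ′ k ≡ lookup τ′ a
    inside (inj₁ k∈) = proj₂ pτ′ a _ (coarser k∈)
    inside (inj₂ k∈) = trans (proj₂ pτ′ b _ (coarser k∈)) (proj₂ pτ′ a b joined)

    outside : ∀ {k} → Other (lookup τ k) → lookup τ′ k ≡ lookup τ k
    outside {k} (≢a , ≢b) = Subset.⊆-antisym (λ j∈ → keep (minimal j∈)) coarser
      where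
      keep : ∀ {j} → j ∈ lookup τ k ⊎ (k ∈⟨ lookup τ a ∣ lookup τ b ⟩ × _) → j ∈ lookup τ k
      keep (inj₁ j∈)            = j∈
      keep (inj₂ (inj₁ k∈ , _)) = ⊥-elim (≢a (proj₂ pτ a k k∈))
      keep (inj₂ (inj₂ k∈ , _)) = ⊥-elim (≢b (proj₂ pτ b k k∈))

    in-others : ∀ {B} → B List∈.∈ others → Other B
    in-others = proj₂ ∘ ∈-filter⁻ other? {xs = blocks τ}

    before-! : Unique (lookup τ a ∷ lookup τ b ∷ others)
    before-! = (a≢b ∷ All.tabulate (λ C∈ e → proj₁ (in-others C∈) (sym e)))
             ∷ All.tabulate (λ C∈ e → proj₂ (in-others C∈) (sym e))
             ∷ Unique.filter⁺ other? (blocks-! τ)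
      where
      a≢b : lookup τ a ≢ lookup τ b
      a≢b e = b∉ (subst (b ∈_) (sym e) (proj₁ pτ b))

    after-! : Unique (lookup τ′ a ∷ others)
    after-! = All.tabulate merged≢ ∷ Unique.filter⁺ other? (blocks-! τ)
      where
      merged≢ : ∀ {C} → C List∈.∈ others → lookup τ′ a ≢ C
      merged≢ C∈ e with k , refl ← ∈-blocks⁻ τ (proj₁ (∈-filter⁻ other? {xs = blocks τ} C∈)) =
        proj₁ (in-others C∈) (sym (proj₂ pτ k a (subst (a ∈_) e (proj₁ pτ′ a))))

    before⊆ : ∀ {B} → B List∈.∈ blocks τ → B List∈.∈ (lookup τ a ∷ lookup τ b ∷ others)
    before⊆ {B} B∈ with B ≟ˢ lookup τ a | B ≟ˢ lookup τ b
    ... | yes refl | _        = here refl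
    ... | no _     | yes refl = there (here refl)
    ... | no ≢a    | no ≢b    = there (there (∈-filter⁺ other? B∈ (≢a , ≢b)))

    before⊇ : ∀ {B} → B List∈.∈ (lookup τ a ∷ lookup τ b ∷ others) → B List∈.∈ blocks τ
    before⊇ (here refl)         = ∈-blocks⁺ τ a
    before⊇ (there (here refl)) = ∈-blocks⁺ τ b
    before⊇ (there (there B∈))  = proj₁ (∈-filter⁻ other? {xs = blocks τ} B∈)

    after⊆ : ∀ {B} → B List∈.∈ blocks τ′ → B List∈.∈ (lookup τ′ a ∷ others)
    after⊆ B∈ with k , refl ← ∈-blocks⁻ τ′ B∈ with k Subset.∈? lookup τ a | k Subset.∈? lookup τ b
    ... | yes k∈ | _      = here (inside (inj₁ k∈))
    ... | no _   | yes k∈ = here (inside (inj₂ k∈))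
    ... | no k∉a | no k∉b = there (subst (List∈._∈ others) (sym (outside other))
                                          (∈-filter⁺ other? (∈-blocks⁺ τ k) other))
      where
      other : Other (lookup τ k)
      other = (λ e → k∉a (subst (k ∈_) e (proj₁ pτ k)))
            , (λ e → k∉b (subst (k ∈_) e (proj₁ pτ k)))

    after⊇ : ∀ {B} → B List∈.∈ (lookup τ′ a ∷ others) → B List∈.∈ blocks τ′
    after⊇ (here refl) = ∈-blocks⁺ τ′ a
    after⊇ (there B∈) with k , refl ← ∈-blocks⁻ τ (before⊇ (there (there B∈))) =
      subst (List∈._∈ blocks τ′) (outside (in-others B∈)) (∈-blocks⁺ τ′ k)

  -- Up to order, the two block lists are one common list of untouched blocks, preceded by two old
  -- blocks in `τ` and by one united block in `τ′`. The hypothesis `b∉` keeps the two old blocks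
  -- distinct.
  numBlocks-merge : numBlocks τ ≡ suc (numBlocks τ′)
  numBlocks-merge =
    trans (↭-length (unique∧⊆∧⊇⇒↭ (blocks-! τ) before-! before⊆ before⊇))
          (cong suc (sym (↭-length (unique∧⊆∧⊇⇒↭ (blocks-! τ′) after-! after⊆ after⊇))))

-- Orbits under composition with a transposition

Step : (Fin n → Fin n) → Rel (Fin n) 0ℓ
Step f i j = f i ≡ j

module _ {f : Fin n → Fin n} (inj : Injective _≡_ _≡_ f) where

  private
    cancel : ∀ {i} a b → a < b → fold i f a ≡ fold i f b → ∃ λ k → f (fold i f k) ≡ i
    cancel zero    (suc k) _         e = k , sym e
    cancel (suc a) (suc b) (s≤s a<b) e = cancel a b a<b (inj e)

    star-fold : ∀ {i} k → Star (Step f) i (fold i f k)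
    star-fold zero    = ε
    star-fold (suc k) = star-fold k ◅◅ (refl ◅ ε)

  -- Among the n + 1 iterates of i from exponent 0 to n two coincide by the pigeonhole principle,
  -- and cancelling f by injectivity yields a k with f^(k+1) i = i. Rotating this closed path by one
  -- step starts it at `f i`. It follows that forward reachability is already symmetric, so `cycles`
  -- is a partition.
  orbit-return : ∀ i → Star (Step f) (f i) i
  orbit-return i
    with a , b , a<b , e ← Fin.pigeonhole (ℕ.n<1+n n) (λ k → fold i f (toℕ k))
    with k , fp≡i ← cancel (toℕ a) (toℕ b) a<b e = rotate (star-fold k) fp≡i
    where
    rotate : ∀ {p} → Star (Step f) i p → f p ≡ i → Star (Step f) (f i) i
    rotate ε          fi≡i = subst (λ j → Star (Step f) j i) (sym fi≡i) ε
    rotate (refl ◅ q) fp≡i = q ◅◅ (fp≡i ◅ ε)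

  orbit-sym : Symmetric (Star (Step f))
  orbit-sym ε          = ε
  orbit-sym (refl ◅ p) = orbit-sym p ◅◅ orbit-return _

-- The pointwise form of g = f ∘ (a b). It is symmetric in f and g, so the case where a cycle splits
-- is the merging case with f and g exchanged.
record Swapped (f g : Fin n → Fin n) (a b : Fin n) : Set where
  field
    at-a : g a ≡ f b
    at-b : g b ≡ f a
    else : ∀ {i} → i ≢ a → i ≢ b → g i ≡ f i

swapped-sym : ∀ {f g : Fin n → Fin n} {a b} → Swapped f g a b → Swapped g f a b
swapped-sym sw = record
  { at-a = sym at-b ; at-b = sym at-a ; else = λ ≢a ≢b → sym (else ≢a ≢b) }
  where open Swapped sw

module _ {f g : Fin n → Fin n} {a b} (f-inj : Injective _≡_ _≡_ f)
         (g-inj : Injective _≡_ _≡_ g) (sw : Swapped f g a b) where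
  open Swapped sw

  module _ (a↛b : ¬ Star (Step f) a b) where

    private
      -- Off a and b the two maps agree, so the f-path remains a g-path up to its first visit to a.
      follow : ∀ {x} → Star (Step f) x a → ¬ Star (Step f) x b → Star (Step g) x a
      follow ε _ = ε
      follow {x} (refl ◅ p) x↛b with x Fin.≟ a
      ... | yes refl = ε
      ... | no x≢a   = else x≢a (λ { refl → x↛b ε }) ◅ follow p (λ q → x↛b (refl ◅ q))

      b→a : Star (Step g) b a
      -- The first g-step from b lands on `f a`; from there the f-orbit of a returns to a without
      -- meeting b.
      b→a = at-b ◅ follow (orbit-return f-inj a) (λ p → a↛b (refl ◅ p))

    orbit-joined : Star (Step g) a b
    orbit-joined = orbit-sym g-inj b→a

    orbit-coarser : ∀ {i j} → Star (Step f) i j → Star (Step g) i j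
    orbit-coarser = step ⋆
      where
      step : ∀ {i j} → Step f i j → Star (Step g) i j
      step {i} refl with i Fin.≟ a | i Fin.≟ b
      ... | yes refl | _        = orbit-joined ◅◅ (at-b ◅ ε)
      ... | no _     | yes refl = b→a ◅◅ (at-a ◅ ε)
      ... | no i≢a   | no i≢b   = else i≢a i≢b ◅ ε

    InUnion : Fin n → Set
    InUnion k = Star (Step f) a k ⊎ Star (Step f) b k

    -- Off a and b the first step of the g-path is a step of f, and `back` undoes it. At a or b the
    -- path already stands in the union; as `g a ≡ f b` and `g b ≡ f a`, a remaining f-path puts j
    -- in the orbit of the other point.
    orbit-minimal : ∀ {i j} → Star (Step g) i j →
                    Star (Step f) i j ⊎ (InUnion i × InUnion j)
    orbit-minimal ε = inj₁ ε
    orbit-minimal {i} {j} (refl ◅ p) with i Fin.≟ a | i Fin.≟ b | orbit-minimal p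
    ... | yes refl | _        | inj₁ q       = inj₂ (inj₁ ε , inj₂ (sym at-a ◅ q))
    ... | yes refl | _        | inj₂ (_ , q) = inj₂ (inj₁ ε , q)
    ... | no _     | yes refl | inj₁ q       = inj₂ (inj₂ ε , inj₁ (sym at-b ◅ q))
    ... | no _     | yes refl | inj₂ (_ , q) = inj₂ (inj₂ ε , q)
    ... | no i≢a   | no i≢b   | inj₁ q       = inj₁ (sym (else i≢a i≢b) ◅ q)
    ... | no i≢a   | no i≢b   | inj₂ (q , r) = inj₂ (Sum.map back back q , r)
      where
      back : ∀ {k} → Star (Step f) k (g i) → Star (Step f) k i
      back q = subst (Star (Step f) _) (else i≢a i≢b) q ◅◅ orbit-return f-inj i

  module _ (a≢b : a ≢ b) where

    private
      -- The vertices whose f-path reaches b before a: a g-invariant set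
      -- that contains b but not a.
      data Avoids : Fin n → Set where
        stop : Avoids b
        step : ∀ {x} → x ≢ a → Avoids (f x) → Avoids x

      ¬avoids-a : ¬ Avoids a
      ¬avoids-a stop         = a≢b refl
      ¬avoids-a (step a≢a _) = a≢a refl

      -- Either the path to b never meets a, or its part after the last visit to a starts at `f a`
      -- and no longer meets a.
      avoids : ∀ {x} → Star (Step f) x b → Avoids x ⊎ Avoids (f a)
      avoids ε = inj₁ stop
      avoids {x} (refl ◅ p) with avoids p | x Fin.≟ a
      ... | inj₂ q | _        = inj₂ q
      ... | inj₁ q | yes refl = inj₂ q
      ... | inj₁ q | no x≢a   = inj₁ (step x≢a q)

    -- Inside `Avoids` the only step where g may differ from f is the one out of b. It leads to
    -- `f a`, which belongs to the set because a reaches b. So the g-orbit of b stays in the set and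
    -- misses a.
    orbit-split : Star (Step f) a b → ¬ Star (Step g) a b
    orbit-split p q = ¬avoids-a (invariant (orbit-sym g-inj q) stop)
      where
      from-fa : Avoids (f a)
      from-fa = Sum.[ ⊥-elim ∘ ¬avoids-a , (λ r → r) ] (avoids p)

      invariant : ∀ {x y} → Star (Step g) x y → Avoids x → Avoids y
      invariant ε r = r
      invariant {x} (refl ◅ p) r with x Fin.≟ b
      invariant (refl ◅ p) r | yes refl = invariant p (subst Avoids (sym at-b) from-fa)
      invariant (refl ◅ p) stop | no b≢b = ⊥-elim (b≢b refl)
      invariant (refl ◅ p) (step x≢a r) | no x≢b =
        invariant p (subst Avoids (sym (else x≢a x≢b)) r)

-- The table of `cyc` for an arbitrary map, so that sums over all maps can refer to it.
cycles : Vec (Fin n) n → Table n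
cycles v = reachTable (λ i j → lookup v i Fin.≟ j)

module _ {v : Vec (Fin n) n} where

  ∈-cycles⁺ : ∀ {i j} → Star (Step (lookup v)) i j → j ∈ lookup (cycles v) i
  ∈-cycles⁺ = ∈-reachTable⁺ (λ i j → lookup v i Fin.≟ j)

  ∈-cycles⁻ : ∀ {i j} → j ∈ lookup (cycles v) i → Star (Step (lookup v)) i j
  ∈-cycles⁻ = ∈-reachTable⁻ (λ i j → lookup v i Fin.≟ j)

  cycles-isPartition : Injective _≡_ _≡_ (lookup v) → IsPartition (cycles v)
  cycles-isPartition inj = reachTable-isPartition _ (orbit-sym inj)

module _ {v w : Vec (Fin n) n} {a b} (a≢b : a ≢ b) (v-inj : Injective _≡_ _≡_ (lookup v))
         (w-inj : Injective _≡_ _≡_ (lookup w)) (sw : Swapped (lookup v) (lookup w) a b) where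

  private
    merged : ∀ v w → Injective _≡_ _≡_ (lookup v) → Injective _≡_ _≡_ (lookup w) →
             Swapped (lookup v) (lookup w) a b → ¬ Star (Step (lookup v)) a b →
             numBlocks (cycles v) ≡ suc (numBlocks (cycles w))
    merged v w v-inj w-inj sw a↛b =
      numBlocks-merge {τ = cycles v} {cycles w} {a} {b} (cycles-isPartition {v = v} v-inj) (cycles-isPartition {v = w} w-inj)
        (a↛b ∘ ∈-cycles⁻ {v = v}) record
        { coarser = ∈-cycles⁺ {v = w} ∘ orbit-coarser v-inj w-inj sw a↛b ∘ ∈-cycles⁻ {v = v}
        ; joined  = ∈-cycles⁺ {v = w} (orbit-joined v-inj w-inj sw a↛b)
        ; minimal = Sum.map c⁺ (Product.map (Sum.map c⁺ c⁺) (Sum.map c⁺ c⁺))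
                  ∘ orbit-minimal v-inj w-inj sw a↛b ∘ ∈-cycles⁻ {v = w}
        }
      where
      c⁺ : ∀ {i j} → Star (Step (lookup v)) i j → j ∈ lookup (cycles v) i
      c⁺ = ∈-cycles⁺ {v = v}

  -- If a and b lie in different cycles of `v`, these merge in `w`. If they share a cycle, it
  -- splits, and the merge leads from `w` back to `v`.
  sign-swapped : sign (numBlocks (cycles w)) ≡ - sign (numBlocks (cycles v))
  sign-swapped with star? (λ i j → lookup v i Fin.≟ j) a b
  ... | no a↛b = sym (trans (cong (λ k → - sign k) (merged v w v-inj w-inj sw a↛b))
                           (neg-sign-suc (numBlocks (cycles w))))
    where
    neg-sign-suc : ∀ k → - sign (suc k) ≡ sign k
    neg-sign-suc k = trans (cong -_ (ℤ.-1*i≡-i (sign k))) (ℤ.neg-involutive (sign k))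
  ... | yes p  = trans (cong sign (merged w v w-inj v-inj (swapped-sym sw)
                                    (orbit-split v-inj w-inj sw a≢b p)))
                       (ℤ.-1*i≡-i (sign (numBlocks (cycles v))))

module _ (a b : Fin n) where

  transpose-a : transpose a b a ≡ b
  transpose-a rewrite dec-true (a Fin.≟ a) refl = refl

  transpose-b : transpose a b b ≡ a
  transpose-b with b Fin.≟ a
  ... | yes b≡a = b≡a
  ... | no _ rewrite dec-true (b Fin.≟ b) refl = refl

  transpose-else : ∀ {i} → i ≢ a → i ≢ b → transpose a b i ≡ i
  transpose-else {i} i≢a i≢b
    rewrite dec-false (i Fin.≟ a) i≢a | dec-false (i Fin.≟ b) i≢b = refl

  transpose-involutive : ∀ i → transpose a b (transpose a b i) ≡ i
  transpose-involutive i = cases (i Fin.≟ a) (i Fin.≟ b)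
    where
    cases : Dec (i ≡ a) → Dec (i ≡ b) → transpose a b (transpose a b i) ≡ i
    cases (yes refl) _          = trans (cong (transpose a b) transpose-a) transpose-b
    cases (no _)     (yes refl) = trans (cong (transpose a b) transpose-b) transpose-a
    cases (no i≢a)   (no i≢b)   =
      trans (cong (transpose a b) (transpose-else i≢a i≢b)) (transpose-else i≢a i≢b)

  swapValues : Vec (Fin n) n → Vec (Fin n) n
  swapValues v = tabulate (λ i → lookup v (transpose a b i))

  lookup-swapValues : ∀ v i → lookup (swapValues v) i ≡ lookup v (transpose a b i)
  lookup-swapValues v = Vec.lookup∘tabulate _

  swapValues-involutive : ∀ v → swapValues (swapValues v) ≡ v
  swapValues-involutive v = lookup-ext λ i →
    trans (lookup-swapValues (swapValues v) i)
      (trans (lookup-swapValues v _) (cong (lookup v) (transpose-involutive i)))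

  swapValues-swapped : ∀ v → Swapped (lookup v) (lookup (swapValues v)) a b
  swapValues-swapped v = record
    { at-a = trans (lookup-swapValues v a) (cong (lookup v) transpose-a)
    ; at-b = trans (lookup-swapValues v b) (cong (lookup v) transpose-b)
    ; else = λ {i} ≢a ≢b → trans (lookup-swapValues v i) (cong (lookup v) (transpose-else ≢a ≢b))
    }

  swapValues-injective : ∀ {v} → Injective _≡_ _≡_ (lookup v) →
                         Injective _≡_ _≡_ (lookup (swapValues v))
  swapValues-injective {v} inj {i} {j} e =
    trans (sym (transpose-involutive i))
      (trans (cong (transpose a b) (inj (trans (sym (lookup-swapValues v i))
                                          (trans e (lookup-swapValues v j)))))
             (transpose-involutive j))

-- Möbius function and rank of a finite poset

module _ (P : FinitePoset) where
  open FinitePoset P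

  module _ (0̂ : Carrier) (0̂-min : ∀ x → 0̂ ≤ᴾ x) (g : Carrier → ℤ) (g-0̂ : g 0̂ ≡ 1ℤ)
           (∑-below : ∀ y → 0̂ ≢ y → ∑ elements (λ z → 𝟙 (z ≤ᴾ? y) * g z) ≡ 0ℤ) where

    private
      split-≤ : ∀ y z → 𝟙 (z ≤ᴾ? y) * g z ≡ 𝟙 (z <ᴾ? y) * g z + 𝟙 (z ≟ᴾ y) * g z
      split-≤ y z with z ≟ᴾ y | z ≤ᴾ? y
      ... | yes refl | no z≰z = ⊥-elim (z≰z (IsPartialOrder.reflexive isPartialOrder refl))
      ... | yes _    | yes _  = sym (ℤ.+-identityˡ _)
      ... | no _     | yes _  = sym (ℤ.+-identityʳ _)
      ... | no _     | no _   = refl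

    -- Because `0̂` is the minimum, the intervals in the recursion are whole down-sets, and
    -- `∑-below` solved for its top term is the recursion of μ. The accessibility proof is arbitrary
    -- since the recursive calls use `rs` and not the canonical proof.
    μ-unique-acc : ∀ y (a : Acc _<ᴾ_ y) → μ-acc 0̂ y a ≡ g y
    μ-unique-acc y (acc rs) with 0̂ ≟ᴾ y | 0̂ ≤ᴾ? y
    ... | yes refl | _    = sym g-0̂
    ... | no _     | no ≰ = ⊥-elim (≰ (0̂-min y))
    ... | no 0̂≢y  | yes _ = begin
      - ∑ elements (λ z → ifYes 0ℤ (0̂ ≤ᴾ? z ×-dec z <ᴾ? y) (λ p → μ-acc 0̂ z (rs (proj₂ p))))
        ≡⟨ cong -_ (∑-cong elements below) ⟩
      - ∑ elements (λ z → 𝟙 (z <ᴾ? y) * g z)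
        ≡⟨ cancel _ (g y) ⟩
      - (∑ elements (λ z → 𝟙 (z <ᴾ? y) * g z) + g y) + g y
        ≡⟨ cong (λ s → - s + g y) (sym total) ⟩
      0ℤ + g y
        ≡⟨ ℤ.+-identityˡ (g y) ⟩
      g y ∎
      where
      open ≡-Reasoning

      cancel : ∀ a b → - a ≡ - (a + b) + b
      cancel = solve-∀

      below : ∀ z → ifYes 0ℤ (0̂ ≤ᴾ? z ×-dec z <ᴾ? y) (λ p → μ-acc 0̂ z (rs (proj₂ p)))
                    ≡ 𝟙 (z <ᴾ? y) * g z
      below z with 0̂ ≤ᴾ? z | z <ᴾ? y
      ... | no ≰  | _       = ⊥-elim (≰ (0̂-min z))
      ... | yes _ | no _    = refl
      ... | yes _ | yes z<y = trans (μ-unique-acc z (rs z<y)) (sym (ℤ.*-identityˡ (g z)))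

      single : ∑ elements (λ z → 𝟙 (z ≟ᴾ y) * g z) ≡ g y
      single = trans
        (∑-single _ unique (complete y)
          (λ z z≢y → cong (_* g z) (𝟙-no (z ≟ᴾ y) z≢y)))
        (trans (cong (_* g y) (𝟙-yes (y ≟ᴾ y) refl)) (ℤ.*-identityˡ (g y)))

      total : 0ℤ ≡ ∑ elements (λ z → 𝟙 (z <ᴾ? y) * g z) + g y
      total = begin
        0ℤ                                                            ≡⟨ sym (∑-below y 0̂≢y) ⟩
        ∑ elements (λ z → 𝟙 (z ≤ᴾ? y) * g z)                          ≡⟨ ∑-cong elements (split-≤ y) ⟩
        ∑ elements (λ z → 𝟙 (z <ᴾ? y) * g z + 𝟙 (z ≟ᴾ y) * g z)       ≡⟨ ∑-+ _ _ elements ⟩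
        ∑ elements (λ z → 𝟙 (z <ᴾ? y) * g z)
          + ∑ elements (λ z → 𝟙 (z ≟ᴾ y) * g z)                       ≡⟨ cong (_+_ (∑ elements (λ z → 𝟙 (z <ᴾ? y) * g z))) single ⟩
        ∑ elements (λ z → 𝟙 (z <ᴾ? y) * g z) + g y                    ∎

    μ-unique : ∀ y → μ 0̂ y ≡ g y
    μ-unique y = μ-unique-acc y (<ᴾ-wellFounded y)

module _ {X : Set} (f : X → ℕ) where

  max≤ : ∀ {b} xs → (∀ x → f x ≤ b) → foldr _⊔_ 0 (map f xs) ≤ b
  max≤ []       f≤b = z≤n
  max≤ (x ∷ xs) f≤b = ℕ.⊔-lub (f≤b x) (max≤ xs f≤b)

  ≤max : ∀ {x xs} → x List∈.∈ xs → f x ≤ foldr _⊔_ 0 (map f xs)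
  ≤max {xs = _ ∷ xs} (here refl) = ℕ.m≤m⊔n _ (foldr _⊔_ 0 (map f xs))
  ≤max {xs = y ∷ xs} (there x∈)  = ℕ.≤-trans (≤max x∈) (ℕ.m≤n⊔m (f y) _)

module _ (P : FinitePoset) where
  open FinitePoset P

  module _ {n} (r : Carrier → ℕ) (r≤n : ∀ x → r x ≤ n) (r-anti : ∀ {z x} → z <ᴾ x → r x < r z)
           (coatom : ∀ x → r x ≡ n ⊎ ∃ λ y → y <ᴾ x × r y ≡ suc (r x)) where

    private
      -- The bound from above comes from r being strictly decreasing, the bound from below from an
      -- element under x whose r is larger by exactly one. The bound `r≤n` keeps the truncated
      -- subtraction exact.
      rk-acc≡ : ∀ x (a : Acc _<ᴾ_ x) → rk-acc x a ≡ n ∸ r x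
      rk-acc≡ x (acc rs) = ℕ.≤-antisym (max≤ f elements upper) (lower (coatom x))
        where
        f : Carrier → ℕ
        f z = ifYes 0 (z <ᴾ? x) (λ z<x → suc (rk-acc z (rs z<x)))

        upper : ∀ z → f z ≤ n ∸ r x
        upper z with z <ᴾ? x
        ... | no _ = z≤n
        ... | yes z<x rewrite rk-acc≡ z (rs z<x) = ℕ.∸-monoʳ-< (r-anti z<x) (r≤n z)

        f-coatom : ∀ z → z <ᴾ x → r z ≡ suc (r x) → n ∸ r x ≤ f z
        f-coatom z z<x rz≡ with z <ᴾ? x
        ... | no z≮x = ⊥-elim (z≮x z<x)
        ... | yes z<x rewrite rk-acc≡ z (rs z<x) | rz≡ =
          ℕ.≤-reflexive (ℕ.+-∸-assoc 1 (subst (_≤ n) rz≡ (r≤n z)))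

        lower : r x ≡ n ⊎ (∃ λ y → y <ᴾ x × r y ≡ suc (r x)) → n ∸ r x ≤ foldr _⊔_ 0 (map f elements)
        lower (inj₁ rx≡n) =
          subst (_≤ foldr _⊔_ 0 (map f elements)) (sym (ℕ.m≤n⇒m∸n≡0 (ℕ.≤-reflexive (sym rx≡n)))) z≤n
        lower (inj₂ (y , y<x , ry≡)) = ℕ.≤-trans (f-coatom y y<x ry≡) (≤max f (complete y))

    rk≡corank : ∀ x → rk x ≡ n ∸ r x
    rk≡corank x = rk-acc≡ x (<ᴾ-wellFounded x)

-- Bond lattices

module _ {n : ℕ} (G : Graph n) where
  open Graph G

  private variable
    B C : Subset n

  bond-isBond : (π : Bond G) → IsBond G (value π)
  bond-isBond (τ , [ p ]) = recompute (isBond? G τ) p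

  bond-isPartition : (π : Bond G) → IsPartition (value π)
  bond-isPartition = proj₁ ∘ bond-isBond

  bond-≡ : {π ρ : Bond G} → value π ≡ value ρ → π ≡ ρ
  bond-≡ refl = refl

  bond-≤⇒⊆ : (π ρ : Bond G) → value π ≤ᵀ value ρ → ∀ i → lookup (value π) i ⊆ lookup (value ρ) i
  bond-≤⇒⊆ π ρ = ≤ᵀ⇒⊆ {σ = value π} {value ρ} (bond-isPartition π) (bond-isPartition ρ)

  induced-mono : B ⊆ C → ∀ {i j} → Star (Induced G B) i j → Star (Induced G C) i j
  induced-mono B⊆C = gmap id (λ (u∈ , v∈ , e) → B⊆C u∈ , B⊆C v∈ , e)

  connected-from : ∀ c → (∀ u → u ∈ B → Star (Induced G B) c u) → Connected G B
  connected-from c paths u v u∈ v∈ =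
    reverse (λ (u∈ , v∈ , e) → v∈ , u∈ , ~-sym e) (paths u u∈) ◅◅ paths v v∈

  0̂-≤ : (π : Bond G) → value (0̂ G) ≤ᵀ value π
  0̂-≤ π i = i , λ j∈ → subst (_∈ lookup (value π) i) (sym (∈-singletons G j∈))
                             (proj₁ (bond-isPartition π) i)

  numBlocks-0̂ : numBlocks (value (0̂ G)) ≡ n
  numBlocks-0̂ = numBlocks-singletons

  module _ (z x : Bond G) (z≤x : value z ≤ᵀ value x) where

    private
      ζ = value z
      ξ = value x
      pζ = bond-isPartition z
      pξ = bond-isPartition x
      ζ⊆ξ = bond-≤⇒⊆ z x z≤x

    leaving-element : z ≢ x → ∃ λ i → ∃ λ j → j ∈ lookup ξ i × j ∉ lookup ζ i
    leaving-element z≢x = decidable-stable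
      (Fin.any? λ i → Fin.any? λ j → (j Subset.∈? lookup ξ i) ×-dec ¬? (j Subset.∈? lookup ζ i))
      λ none → z≢x (bond-≡ (lookup-ext λ i → Subset.⊆-antisym (ζ⊆ξ i) λ {j} j∈ →
        decidable-stable (j Subset.∈? lookup ζ i) λ j∉ → none (i , j , j∈ , j∉)))

    -- The path starts in the `ζ`-block of i and ends outside it; the edge sought is the first one
    -- that leaves this block.
    leaving-edge : ∀ {i j} → Star (Induced G (lookup ξ i)) i j → j ∉ lookup ζ i →
                   ∃ λ u → ∃ λ v → Induced G (lookup ξ i) u v × v ∉ lookup ζ u
    leaving-edge {i} p j∉ = walk p (proj₁ pζ i) j∉
      where
      walk : ∀ {u j} → Star (Induced G (lookup ξ i)) u j → u ∈ lookup ζ i → j ∉ lookup ζ i →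
             ∃ λ u → ∃ λ v → Induced G (lookup ξ i) u v × v ∉ lookup ζ u
      walk ε u∈ j∉ = ⊥-elim (j∉ u∈)
      walk {u} (_◅_ {j = v} e p) u∈ j∉ with v Subset.∈? lookup ζ i
      ... | yes v∈ = walk p v∈ j∉
      ... | no v∉  = u , v , e , λ v∈ → v∉ (∈-block-trans {τ = ζ} pζ u∈ v∈)

    module _ {u v} (v∉u : v ∉ lookup ζ u) (u~v : u ~ v) (v∈u : v ∈ lookup ξ u) where

      private
        U : Subset n
        U = lookup ζ u ∪ lookup ζ v

        merged : Table n
        merged = tabulate λ k → if does (k Subset.∈? U) then U else lookup ζ k

        merged-in : ∀ {k} → k ∈ U → lookup merged k ≡ U
        merged-in {k} k∈ = trans (Vec.lookup∘tabulate _ k) eq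
          where
          eq : (if does (k Subset.∈? U) then U else lookup ζ k) ≡ U
          eq with k Subset.∈? U
          ... | yes _ = refl
          ... | no k∉ = ⊥-elim (k∉ k∈)

        merged-out : ∀ {k} → k ∉ U → lookup merged k ≡ lookup ζ k
        merged-out {k} k∉ = trans (Vec.lookup∘tabulate _ k) eq
          where
          eq : (if does (k Subset.∈? U) then U else lookup ζ k) ≡ lookup ζ k
          eq with k Subset.∈? U
          ... | yes k∈ = ⊥-elim (k∉ k∈)
          ... | no _   = refl

        u-side : lookup ζ u ⊆ U
        u-side = Subset.p⊆p∪q (lookup ζ v)

        v-side : lookup ζ v ⊆ U
        v-side = Subset.q⊆p∪q (lookup ζ u) (lookup ζ v)

        U-saturated : ∀ {k j} → k ∈ U → j ∈ lookup ζ k → j ∈ U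
        U-saturated k∈ j∈ = Subset.x∈p∪q⁺ (Sum.map
          (λ k∈ → ∈-block-trans {τ = ζ} pζ k∈ j∈) (λ k∈ → ∈-block-trans {τ = ζ} pζ k∈ j∈)
          (Subset.x∈p∪q⁻ _ _ k∈))

        merged-isPartition : IsPartition merged
        merged-isPartition = rfl , block
          where
          rfl : ∀ i → i ∈ lookup merged i
          rfl i with i Subset.∈? U
          ... | yes i∈ = subst (i ∈_) (sym (merged-in i∈)) i∈
          ... | no i∉  = subst (i ∈_) (sym (merged-out i∉)) (proj₁ pζ i)

          block : ∀ i j → j ∈ lookup merged i → lookup merged j ≡ lookup merged i
          block i j j∈ with i Subset.∈? U
          ... | yes i∈ = trans (merged-in (subst (j ∈_) (merged-in i∈) j∈)) (sym (merged-in i∈))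
          ... | no i∉  = trans (merged-out (λ j∈U → i∉ (U-saturated j∈U (∈-block-sym {τ = ζ} pζ j∈i))))
                           (trans (proj₂ pζ i j j∈i) (sym (merged-out i∉)))
            where j∈i = subst (j ∈_) (merged-out i∉) j∈

        U-connected : Connected G U
        U-connected = connected-from u λ k k∈ → path (Subset.x∈p∪q⁻ _ _ k∈)
          where
          inner : ∀ i {k} → k ∈ lookup ζ i → Star (Induced G (lookup ζ i)) i k
          inner i k∈ = proj₂ (bond-isBond z) i i _ (proj₁ pζ i) k∈

          path : ∀ {k} → k ∈ lookup ζ u ⊎ k ∈ lookup ζ v → Star (Induced G U) u k
          path (inj₁ k∈) = induced-mono u-side (inner u k∈)
          path (inj₂ k∈) = (u-side (proj₁ pζ u) , v-side (proj₁ pζ v) , u~v)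
                         ◅ induced-mono v-side (inner v k∈)

        merged-connected : ∀ i → Connected G (lookup merged i)
        merged-connected i with i Subset.∈? U
        ... | yes i∈ = subst (Connected G) (sym (merged-in i∈)) U-connected
        ... | no i∉  = subst (Connected G) (sym (merged-out i∉)) (proj₂ (bond-isBond z) i)

        merged-isMerge : IsMerge ζ merged u v
        merged-isMerge = record
          { coarser = coarser
          ; joined  = subst (v ∈_) (sym (merged-in (u-side (proj₁ pζ u)))) (v-side (proj₁ pζ v))
          ; minimal = minimal
          }
          where
          coarser : ∀ {i} → lookup ζ i ⊆ lookup merged i
          coarser {i} {j} j∈ with i Subset.∈? U
          ... | yes i∈ = subst (j ∈_) (sym (merged-in i∈)) (U-saturated i∈ j∈)
          ... | no i∉  = subst (j ∈_) (sym (merged-out i∉)) j∈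

          minimal : ∀ {i j} → j ∈ lookup merged i → j ∈ lookup ζ i ⊎
                    (i ∈⟨ lookup ζ u ∣ lookup ζ v ⟩ × j ∈⟨ lookup ζ u ∣ lookup ζ v ⟩)
          minimal {i} {j} j∈ with i Subset.∈? U
          ... | yes i∈ = inj₂ (Subset.x∈p∪q⁻ _ _ i∈ ,
                               Subset.x∈p∪q⁻ _ _ (subst (j ∈_) (merged-in i∈) j∈))
          ... | no i∉  = inj₁ (subst (j ∈_) (merged-out i∉) j∈)

        merged-≤ : merged ≤ᵀ ξ
        merged-≤ i with i Subset.∈? U
        ... | yes i∈ = u , λ {j} j∈ → below (Subset.x∈p∪q⁻ _ _ (subst (j ∈_) (merged-in i∈) j∈))
          where
          below : ∀ {j} → j ∈ lookup ζ u ⊎ j ∈ lookup ζ v → j ∈ lookup ξ u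
          below (inj₁ j∈) = ζ⊆ξ u j∈
          below (inj₂ j∈) = ∈-block-trans {τ = ξ} pξ v∈u (ζ⊆ξ v j∈)
        ... | no i∉  = i , λ {j} j∈ → ζ⊆ξ i (subst (j ∈_) (merged-out i∉) j∈)

      merge-along : ∃ λ (y : Bond G) → value y ≤ᵀ ξ × numBlocks ζ ≡ suc (numBlocks (value y))
      merge-along =
        (merged , [ merged-isPartition , merged-connected ]) , merged-≤ ,
        numBlocks-merge {τ = ζ} {merged} pζ merged-isPartition v∉u merged-isMerge

    -- A block of x that is not a single block of z is connected, hence contains an edge between two
    -- different blocks of z. That edge connects their union, so the merge is again a bond.
    merge-step : z ≢ x → ∃ λ (y : Bond G) → value y ≤ᵀ ξ × numBlocks ζ ≡ suc (numBlocks (value y))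
    merge-step z≢x
      with i , j , j∈ , j∉ ← leaving-element z≢x
      with u , v , (u∈ , v∈ , u~v) , v∉u ←
             leaving-edge (proj₂ (bond-isBond x) i i j (proj₁ pξ i) j∈) j∉ =
      merge-along v∉u u~v (subst (v ∈_) (sym (proj₂ pξ i u u∈)) v∈)

  -- Ranks and length of the bond lattice

  open FinitePoset (bondLattice G) using (_<ᴾ_; rk; len)

  private
    _≟ᴮ_ : (π ρ : Bond G) → Dec (π ≡ ρ)
    _≟ᴮ_ = FinitePoset._≟ᴾ_ (bondLattice G)

  module _ (x : Bond G) where

    private
      ∣x∣ = numBlocks (value x)

      Coatom : Set
      Coatom = ∃ λ (y : Bond G) → y <ᴾ x × numBlocks (value y) ≡ suc ∣x∣

      -- Induction on the number of blocks of z: each merge loses exactly one block and stays below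
      -- x. When the merge gives x, z itself is the required element; otherwise the climb continues
      -- from the merged bond. The strict inequality is collected on the way.
      climb : ∀ k z → value z ≤ᵀ value x → z ≢ x → numBlocks (value z) ≡ k → ∣x∣ < k × Coatom
      climb k z z≤x z≢x z≡k = next k (merge-step z x z≤x z≢x) z≡k
        where
        next : ∀ k → (∃ λ (y : Bond G) → value y ≤ᵀ value x ×
               numBlocks (value z) ≡ suc (numBlocks (value y))) →
               numBlocks (value z) ≡ k → ∣x∣ < k × Coatom
        next zero (y , y≤x , z≡) z≡0 = ⊥-elim (ℕ.1+n≢0 (trans (sym z≡) z≡0))
        next (suc k) (y , y≤x , z≡) z≡k = cases (y ≟ᴮ x)
          where
          y≡k : numBlocks (value y) ≡ k
          y≡k = ℕ.suc-injective (trans (sym z≡) z≡k)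

          cases : Dec (y ≡ x) → ∣x∣ < suc k × Coatom
          cases (yes y≡x) = s≤s (ℕ.≤-reflexive ∣x∣≡k) ,
                            (z , (z≤x , z≢x) , trans z≡k (cong suc (sym ∣x∣≡k)))
            where ∣x∣≡k = trans (cong (numBlocks ∘ value) (sym y≡x)) y≡k
          cases (no y≢x) with climb k y y≤x y≢x y≡k
          ... | ∣x∣<k , c = ℕ.m<n⇒m<1+n ∣x∣<k , c

    numBlocks-< : ∀ z → z <ᴾ x → numBlocks (value x) < numBlocks (value z)
    numBlocks-< z (z≤x , z≢x) = proj₁ (climb _ z z≤x z≢x refl)

    numBlocks-≤ : ∀ z → value z ≤ᵀ value x → numBlocks (value x) ≤ numBlocks (value z)
    numBlocks-≤ z z≤x = cases (z ≟ᴮ x)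
      where
      cases : Dec (z ≡ x) → numBlocks (value x) ≤ numBlocks (value z)
      cases (yes z≡x) = ℕ.≤-reflexive (cong (numBlocks ∘ value) (sym z≡x))
      cases (no z≢x)  = ℕ.<⇒≤ (numBlocks-< z (z≤x , z≢x))

    numBlocks≤n : numBlocks (value x) ≤ n
    numBlocks≤n = subst (numBlocks (value x) ≤_) numBlocks-0̂ (numBlocks-≤ (0̂ G) (0̂-≤ x))

    coatom : numBlocks (value x) ≡ n ⊎ Coatom
    coatom = cases (0̂ G ≟ᴮ x)
      where
      cases : Dec (0̂ G ≡ x) → numBlocks (value x) ≡ n ⊎ Coatom
      cases (yes 0̂≡x) = inj₁ (trans (cong (numBlocks ∘ value) (sym 0̂≡x)) numBlocks-0̂)
      cases (no 0̂≢x)  = inj₂ (proj₂ (climb _ (0̂ G) (0̂-≤ x) 0̂≢x refl))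

  rk≡ : ∀ x → rk x ≡ n ∸ numBlocks (value x)
  rk≡ = rk≡corank (bondLattice G) (numBlocks ∘ value) numBlocks≤n (numBlocks-< _ _) coatom

  components : Table n
  components = reachTable _~?_

  private
    stays : ∀ {i u v} → u ∈ lookup components i → Star _~_ u v →
            Star (Induced G (lookup components i)) u v
    stays u∈ ε       = ε
    stays u∈ (e ◅ p) = (u∈ , w∈ , e) ◅ stays w∈ p
      where w∈ = ∈-reachTable⁺ _~?_ (∈-reachTable⁻ _~?_ u∈ ◅◅ (e ◅ ε))

    components-isBond : IsBond G components
    components-isBond = isPart , λ i → connected-from i λ u u∈ →
      stays (proj₁ isPart i) (∈-reachTable⁻ _~?_ u∈)
      where isPart = reachTable-isPartition _~?_ (reverse ~-sym)

  componentBond : Bond G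
  componentBond = components , [ components-isBond ]

  ≤-componentBond : ∀ x → value x ≤ᵀ components
  ≤-componentBond x i = i , λ {j} j∈ → ∈-reachTable⁺ _~?_
    (gmap id (proj₂ ∘ proj₂) (proj₂ (bond-isBond x) i i j (proj₁ (bond-isPartition x) i) j∈))

  numComponents≤ : ∀ x → numComponents G ≤ numBlocks (value x)
  numComponents≤ x = numBlocks-≤ componentBond x (≤-componentBond x)

  -- The partition into components lies above every bond, so it has the fewest blocks and the
  -- largest rank.
  len≡ : len ≡ n ∸ numComponents G
  len≡ = ℕ.≤-antisym
    (max≤ rk (bonds G) λ x → ℕ.≤-trans (ℕ.≤-reflexive (rk≡ x)) (ℕ.∸-monoʳ-≤ n (numComponents≤ x)))
    (ℕ.≤-trans (ℕ.≤-reflexive (sym (rk≡ componentBond)))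
               (≤max rk (FinitePoset.complete (bondLattice G) componentBond)))

-- D-permutations

least : ∀ {n} {P : Fin n → Set} → Unary.Decidable P → ∃ P →
        ∃ λ a → P a × (∀ j → P j → a Fin.≤ j)
least {suc n} P? (i , pi) with P? zero
... | yes p0 = zero , p0 , λ _ _ → z≤n
least {suc n} P? (zero , p0)   | no ¬p0 = ⊥-elim (¬p0 p0)
least {suc n} P? (suc i , pi)  | no ¬p0 with a , pa , a≤ ← least (P? ∘ suc) (i , pi) =
  suc a , pa , λ { zero p0 → ⊥-elim (¬p0 p0) ; (suc j) pj → s≤s (a≤ j pj) }

greatest : ∀ {n} {P : Fin n → Set} → Unary.Decidable P → ∃ P →
           ∃ λ b → P b × (∀ j → P j → j Fin.≤ b)
greatest {suc n} P? (i , pi) with Fin.any? (P? ∘ suc)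
... | yes q with b , pb , ≤b ← greatest (P? ∘ suc) q =
  suc b , pb , λ { zero _ → z≤n ; (suc j) pj → s≤s (≤b j pj) }
greatest {suc n} P? (zero , p0)  | no ¬q = zero , p0 , λ { zero _ → z≤n ; (suc j) pj → ⊥-elim (¬q (j , pj)) }
greatest {suc n} P? (suc i , pi) | no ¬q = ⊥-elim (¬q (i , pi))

sign² : ∀ k → sign k * sign k ≡ 1ℤ
sign² zero    = refl
sign² (suc k) = trans (square (sign k)) (sign² k)
  where
  square : ∀ s → (-1ℤ * s) * (-1ℤ * s) ≡ s * s
  square = solve-∀

module _ (A : FiniteSubset) (m : ℕ) where
  open FiniteSubset A
  open Graph (Γ A m)

  private
    el : Fin size → ℕ
    el = element

    variable
      i j : Fin size

  element-mono : i Fin.≤ j → el i ≤ el j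
  element-mono {i} {j} i≤j = cases (i Fin.≟ j)
    where
    cases : Dec (i ≡ j) → el i ≤ el j
    cases (yes refl) = ℕ.≤-refl
    cases (no i≢j)   = ℕ.<⇒≤ (increasing (Fin.≤∧≢⇒< i≤j i≢j))

  element-injective : el i ≡ el j → i ≡ j
  element-injective {i} {j} e = cases (ℕ.<-cmp (Fin.toℕ i) (Fin.toℕ j))
    where
    cases : Tri (i Fin.< j) (Fin.toℕ i ≡ Fin.toℕ j) (j Fin.< i) → i ≡ j
    cases (tri< i<j _ _) = ⊥-elim (ℕ.<-irrefl e (increasing i<j))
    cases (tri≈ _ e′ _)  = Fin.toℕ-injective e′
    cases (tri> _ _ j<i) = ⊥-elim (ℕ.<-irrefl (sym e) (increasing j<i))

  -- In the 0-1 matrix of admissible pairs (i , σ i), the rows of the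
  -- minimum a and of the maximum b of B are full on B.
  record FullPair (B : Subset size) : Set where
    field
      {a b}  : Fin size
      a∈     : a ∈ B
      b∈     : b ∈ B
      a≢b    : a ≢ b
      a-min  : ∀ {j} → j ∈ B → el a ≤ el j
      b-max  : ∀ {j} → j ∈ B → el j ≤ el b
      a-odd  : Odd (el a)
      b-full : Even (el b) ⊎ InR m (el b)

  -- The first edge of a path from a to b inside B must go upwards from the minimum a, and arcs
  -- start at odd vertices only. The first edge of a path from b to a must come from below, and arcs
  -- end at even vertices or at odd ones not exceeding m.
  connected⇒fullPair : ∀ {B} → Connected (Γ A m) B → ∀ {i j} → i ∈ B → j ∈ B → i ≢ j → FullPair B
  connected⇒fullPair {B} conn {i} {j} i∈ j∈ i≢j
    with a , a∈ , a≤ ← least (Subset._∈? B) (i , i∈)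
    with b , b∈ , ≤b ← greatest (Subset._∈? B) (i , i∈) = record
    { a∈ = a∈ ; b∈ = b∈ ; a≢b = a≢b
    ; a-min = λ j∈ → element-mono (a≤ _ j∈) ; b-max = λ j∈ → element-mono (≤b _ j∈)
    ; a-odd = min-odd (conn a b a∈ b∈) ; b-full = max-full (conn b a b∈ a∈)
    }
    where
    a≢b : a ≢ b
    a≢b refl = i≢j (trans (Fin.≤-antisym (≤b i i∈) (a≤ i i∈)) (Fin.≤-antisym (a≤ j j∈) (≤b j j∈)))

    min-odd : Star (Induced (Γ A m) B) a b → Odd (el a)
    min-odd ε = ⊥-elim (a≢b refl)
    min-odd ((_ , u∈ , inj₁ (inj₁ (_ , odd , _))) ◅ _)     = odd
    min-odd ((_ , u∈ , inj₁ (inj₂ (_ , _ , odd , _))) ◅ _) = odd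
    min-odd ((_ , u∈ , inj₂ (inj₁ (u<a , _))) ◅ _) = ⊥-elim (ℕ.<⇒≱ u<a (element-mono (a≤ _ u∈)))
    min-odd ((_ , u∈ , inj₂ (inj₂ (u<a , _))) ◅ _) = ⊥-elim (ℕ.<⇒≱ u<a (element-mono (a≤ _ u∈)))

    max-full : Star (Induced (Γ A m) B) b a → Even (el b) ⊎ InR m (el b)
    max-full ε = ⊥-elim (a≢b refl)
    max-full ((_ , u∈ , inj₁ (inj₁ (b<u , _))) ◅ _) = ⊥-elim (ℕ.<⇒≱ b<u (element-mono (≤b _ u∈)))
    max-full ((_ , u∈ , inj₁ (inj₂ (b<u , _))) ◅ _) = ⊥-elim (ℕ.<⇒≱ b<u (element-mono (≤b _ u∈)))
    max-full ((_ , u∈ , inj₂ (inj₁ (_ , _ , even))) ◅ _) = inj₁ even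
    max-full ((_ , u∈ , inj₂ (inj₂ (_ , b≤m , _ , odd))) ◅ _) = inj₂ (odd , b≤m)

  module _ {v : Vec (Fin size) size} (D : IsDPermutation A m v) where

    private
      inj : Injective _≡_ _≡_ (lookup v)
      inj = proj₁ (proj₁ D)

      part : IsPartition (cycles v)
      part = cycles-isPartition {v = v} inj

      image∈ : ∀ {i j} → j ∈ lookup (cycles v) i → lookup v j ∈ lookup (cycles v) i
      image∈ {i} {j} j∈ = ∈-cycles⁺ {v = v} (∈-cycles⁻ {v = v} j∈ ◅◅ (refl ◅ ε))

      same : ∀ {i j k} → j ∈ lookup (cycles v) i → k ∈ lookup (cycles v) i →
             Star (Step (lookup v)) j k
      same {i} {j} {k} j∈ k∈ =
        ∈-cycles⁻ {v = v} (subst (k ∈_) (sym (proj₂ part i j j∈)) k∈)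

      fixed : ∀ {j k} → lookup v j ≡ j → Star (Step (lookup v)) j k → k ≡ j
      fixed _  ε          = refl
      fixed vj (refl ◅ p) = trans (fixed (cong (lookup v) vj) p) vj

    -- The minimum a of a nontrivial cycle is odd, hence adjacent to the
    -- even elements and to those in R; the other elements are adjacent
    -- to the maximum b, which is then even.
    cycle-connected : ∀ i → Connected (Γ A m) (lookup (cycles v) i)
    cycle-connected i
      with a , a∈ , a≤ ← least (Subset._∈? lookup (cycles v) i) (i , proj₁ part i)
      with b , b∈ , ≤b ← greatest (Subset._∈? lookup (cycles v) i) (i , proj₁ part i) =
      connected-from (Γ A m) a λ u u∈ → path u u∈ (u Fin.≟ a)
      where
      C = lookup (cycles v) i

      path : ∀ u → u ∈ C → Dec (u ≡ a) → Star (Induced (Γ A m) C) a u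
      path u u∈ (yes refl) = ε
      path u u∈ (no u≢a)   = cases (2 ∣? el u) (el u ℕ.≤? m) (2 ∣? el b)
        where
        a<u : el a < el u
        a<u = increasing (Fin.≤∧≢⇒< (a≤ u u∈) (u≢a ∘ sym))

        a-odd : Odd (el a)
        -- An even minimum is not moved upwards by the permutation nor downwards within its cycle,
        -- so it is fixed and its cycle has no other element u.
        a-odd even = u≢a (fixed (element-injective (ℕ.≤-antisym
          (proj₂ (proj₂ D) a even) (element-mono (a≤ _ (image∈ a∈))))) (same a∈ u∈))

        u≤b : el u ≤ el b
        u≤b = element-mono (≤b u u∈)

        b-inR : Odd (el b) → InR m (el b)
        -- An odd maximum outside R would likewise be fixed, which would collapse the cycle to one
        -- element and identify u with a.
        b-inR odd = decidable-stable (inR? m (el b)) λ b∉R →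
          let vb≡b = element-injective (ℕ.≤-antisym
                (element-mono (≤b _ (image∈ b∈))) (proj₁ (proj₂ D) b odd b∉R))
          in u≢a (trans (fixed vb≡b (same b∈ u∈)) (sym (fixed vb≡b (same b∈ a∈))))

        cases : Dec (Even (el u)) → Dec (el u ≤ m) → Dec (Even (el b)) →
                Star (Induced (Γ A m) C) a u
        cases (yes even) _ _ = (a∈ , u∈ , inj₁ (inj₁ (a<u , a-odd , even))) ◅ ε
        cases (no odd) (yes u≤m) _ = (a∈ , u∈ , inj₁ (inj₂ (a<u , u≤m , a-odd , odd))) ◅ ε
        cases (no odd) (no u≰m) (yes even) =
            (a∈ , b∈ , inj₁ (inj₁ (ℕ.<-≤-trans a<u u≤b , a-odd , even)))
          ◅ (b∈ , u∈ , inj₂ (inj₁ (u<b , odd , even))) ◅ ε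
          where
          u<b : el u < el b
          u<b = ℕ.≤∧≢⇒< u≤b λ e → odd (subst Even (sym e) even)
        -- An odd b lies in R, so u ≤ b ≤ m, against the assumption on u.
        cases (no odd) (no u≰m) (no b-odd) =
          ⊥-elim (u≰m (ℕ.≤-trans u≤b (proj₂ (b-inR b-odd))))

    cycles-isBond : IsBond (Γ A m) (cycles v)
    cycles-isBond = part , cycle-connected

  module _ {v : Vec (Fin size) size} {τ : Table size} (v-inj : Injective _≡_ _≡_ (lookup v))
           (pτ : IsPartition τ) where

    -- Replaces refinement of partitions by a condition on each pair (i, σ i) separately, which can
    -- be checked after the exchange of two values.
    cycles≤⇒respects : cycles v ≤ᵀ τ → ∀ i → lookup v i ∈ lookup τ i
    cycles≤⇒respects le i =
      ≤ᵀ⇒⊆ {σ = cycles v} {τ} (cycles-isPartition {v = v} v-inj) pτ le i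
        (∈-cycles⁺ {v = v} (refl ◅ ε))

    respects⇒cycles≤ : (∀ i → lookup v i ∈ lookup τ i) → cycles v ≤ᵀ τ
    respects⇒cycles≤ resp i = i , walk ∘ ∈-cycles⁻ {v = v}
      where
      walk : ∀ {i j} → Star (Step (lookup v)) i j → j ∈ lookup τ i
      walk ε          = proj₁ pτ _
      walk (refl ◅ p) = ∈-block-trans {τ = τ} pτ (resp _) (walk p)

  module _ (y : Bond (Γ A m)) {i} (fp : FullPair (lookup (value y) i)) where
    open FullPair fp

    private
      τ = value y
      pτ = bond-isPartition (Γ A m) y
      B = lookup τ i

      Good : Vec (Fin size) size → Set
      Good v = IsDPermutation A m v × cycles v ≤ᵀ τ

      good? : Unary.Decidable Good
      good? v = isDPermutation? A m v ×-dec (cycles v ≤ᵀ? τ)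

      weight : Vec (Fin size) size → ℤ
      weight v = 𝟙 (good? v) * sign (numBlocks (cycles v))

      φ : Vec (Fin size) size → Vec (Fin size) size
      φ = swapValues a b

      τa : lookup τ a ≡ B
      τa = proj₂ pτ i a a∈

      τb : lookup τ b ≡ B
      τb = proj₂ pτ i b b∈

      good-φ : ∀ v → Good v → Good (φ v)
      good-φ v ((( v-inj , v-surj) , odd-cond , even-cond) , le) =
        ((φ-inj , φ-surj) , φ-odd , φ-even) ,
        respects⇒cycles≤ {v = φ v} {τ} φ-inj pτ φ-respects
        where
        open Swapped (swapValues-swapped a b v)

        respects : ∀ i → lookup v i ∈ lookup τ i
        respects = cycles≤⇒respects {v = v} {τ} v-inj pτ le

        va∈ : lookup v a ∈ B
        va∈ = subst (lookup v a ∈_) τa (respects a)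

        vb∈ : lookup v b ∈ B
        vb∈ = subst (lookup v b ∈_) τb (respects b)

        -- All requirements on a good map other than bijectivity concern single pairs (i, σ i), so
        -- after the exchange only those at a and b need a new argument.
        by-position : (P : Fin size → Fin size → Set) → P a (lookup v b) → P b (lookup v a) →
                      (∀ i → P i (lookup v i)) → ∀ i → P i (lookup (φ v) i)
        by-position P Pa Pb Pv i = cases (i Fin.≟ a) (i Fin.≟ b)
          where
          cases : Dec (i ≡ a) → Dec (i ≡ b) → P i (lookup (φ v) i)
          cases (yes refl) _          = subst (P a) (sym at-a) Pa
          cases (no _)     (yes refl) = subst (P b) (sym at-b) Pb
          cases (no i≢a)   (no i≢b)   = subst (P i) (sym (else i≢a i≢b)) (Pv i)

        φ-inj : Injective _≡_ _≡_ (lookup (φ v))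
        φ-inj = swapValues-injective a b {v} v-inj

        φ-surj : Surjective _≡_ _≡_ (lookup (φ v))
        φ-surj k with x , vx≡k ← v-surj k = transpose a b x , λ { refl →
          trans (lookup-swapValues a b v (transpose a b x)) (vx≡k (transpose-involutive a b x)) }

        φ-odd : ∀ i → Odd (el i) → ¬ InR m (el i) → el i ≤ el (lookup (φ v) i)
        φ-odd = by-position (λ i j → Odd (el i) → ¬ InR m (el i) → el i ≤ el j)
          (λ _ _ → a-min vb∈)
          (λ b-odd b∉R → ⊥-elim (not-full b-odd b∉R b-full))
          odd-cond
          where
          not-full : Odd (el b) → ¬ InR m (el b) → ¬ (Even (el b) ⊎ InR m (el b))
          not-full b-odd _   (inj₁ even) = b-odd even
          not-full _     b∉R (inj₂ inR)  = b∉R inR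

        φ-even : ∀ i → Even (el i) → el (lookup (φ v) i) ≤ el i
        φ-even = by-position (λ i j → Even (el i) → el j ≤ el i)
          (λ even → ⊥-elim (a-odd even)) (λ _ → b-max va∈) even-cond

        φ-respects : ∀ i → lookup (φ v) i ∈ lookup τ i
        φ-respects = by-position (λ i j → j ∈ lookup τ i)
          (subst (lookup v b ∈_) (sym τa) vb∈) (subst (lookup v a ∈_) (sym τb) va∈) respects

      weight-φ : ∀ v → weight (φ v) ≡ - weight v
      weight-φ v = cases (good? v)
        where
        open ≡-Reasoning
        cases : Dec (Good v) → weight (φ v) ≡ - weight v
        cases (yes good) = begin
          𝟙 (good? (φ v)) * sign (numBlocks (cycles (φ v)))
            ≡⟨ cong₂ _*_ (trans (𝟙-yes (good? (φ v)) (good-φ v good)) (sym (𝟙-yes (good? v) good)))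
                         (sign-swapped {v = v} {φ v} a≢b v-inj (swapValues-injective a b {v} v-inj)
                                       (swapValues-swapped a b v)) ⟩
          𝟙 (good? v) * - sign (numBlocks (cycles v))
            ≡⟨ sym (ℤ.neg-distribʳ-* (𝟙 (good? v)) (sign (numBlocks (cycles v)))) ⟩
          - weight v ∎
          where
          v-inj : Injective _≡_ _≡_ (lookup v)
          v-inj = proj₁ (proj₁ (proj₁ good))
        -- Being its own inverse, φ also reflects goodness, so both weights vanish.
        cases (no bad) = begin
          𝟙 (good? (φ v)) * sign (numBlocks (cycles (φ v)))
            ≡⟨ cong (_* sign (numBlocks (cycles (φ v)))) (𝟙-no (good? (φ v))
                 (λ good → bad (subst Good (swapValues-involutive a b v) (good-φ (φ v) good)))) ⟩
          0ℤ
            ≡⟨ cong (λ t → - (t * sign (numBlocks (cycles v)))) (sym (𝟙-no (good? v) bad)) ⟩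
          - weight v ∎

    ∑-weight≡0 : ∑ (vectors (allFin size) size) weight ≡ 0ℤ
    ∑-weight≡0 = ∑-involution (vectors-unique (Unique.allFin⁺ size) size) (vectors-complete ∈-allFin)
      φ (swapValues-involutive a b) weight weight-φ

-- Coefficients of polynomials

coeff-+ₚ : ∀ p q j → coeff (p +ₚ q) j ≡ coeff p j + coeff q j
coeff-+ₚ []      q       j       = sym (ℤ.+-identityˡ (coeff q j))
coeff-+ₚ (a ∷ p) []      j       = sym (ℤ.+-identityʳ (coeff (a ∷ p) j))
coeff-+ₚ (a ∷ p) (b ∷ q) zero    = refl
coeff-+ₚ (a ∷ p) (b ∷ q) (suc j) = coeff-+ₚ p q j

coeff-·ₚ : ∀ c p j → coeff (c ·ₚ p) j ≡ c * coeff p j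
coeff-·ₚ c []      j       = sym (ℤ.*-zeroʳ c)
coeff-·ₚ c (a ∷ p) zero    = refl
coeff-·ₚ c (a ∷ p) (suc j) = coeff-·ₚ c p j

module _ {X : Set} (f : X → Poly) where

  coeff-sumₚ : ∀ xs j → coeff (sumₚ (map f xs)) j ≡ ∑ xs (λ x → coeff (f x) j)
  coeff-sumₚ []       j = refl
  coeff-sumₚ (x ∷ xs) j = trans (coeff-+ₚ (f x) (sumₚ (map f xs)) j)
                                (cong (_+_ (coeff (f x) j)) (coeff-sumₚ xs j))

  coeff-shift-sumₚ : ∀ e xs j → coeff (shift e (sumₚ (map f xs))) j
                                ≡ ∑ xs (λ x → coeff (shift e (f x)) j)
  coeff-shift-sumₚ zero    xs j       = coeff-sumₚ xs j
  coeff-shift-sumₚ (suc e) xs zero    = sym (∑-zero xs (λ _ → refl))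
  coeff-shift-sumₚ (suc e) xs (suc j) = coeff-shift-sumₚ e xs j

coeff-monomial : ∀ a e j → coeff (monomial a e) j ≡ 𝟙 (e ℕ.≟ j) * a
coeff-monomial a zero    zero    = sym (ℤ.*-identityˡ a)
coeff-monomial a zero    (suc j) = refl
coeff-monomial a (suc e) zero    = refl
coeff-monomial a (suc e) (suc j) = trans (coeff-monomial a e j)
  (cong (_* a) (𝟙-cong (e ℕ.≟ j) (suc e ℕ.≟ suc j) (cong suc) ℕ.suc-injective))

shift-monomial : ∀ d a e → shift d (monomial a e) ≡ monomial a (d ℕ.+ e)
shift-monomial zero    a e = refl
shift-monomial (suc d) a e = cong (0ℤ ∷_) (shift-monomial d a e)

-- Here n ∸ c is the length of the lattice, c being the number of components, and n ∸ k the rank of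
-- a bond with k blocks. The exponent k - c in χ becomes k - 1 after the shift; the inequalities
-- keep every truncated subtraction exact.
corank-exponent : ∀ {c k n} → 1 ≤ c → c ≤ k → k ≤ n → (c ∸ 1) ℕ.+ ((n ∸ c) ∸ (n ∸ k)) ≡ k ∸ 1
corank-exponent {suc c} {k} {n} _ c≤k k≤n
  with d , refl ← ℕ.m≤n⇒∃[o]m+o≡n c≤k
  with e , refl ← ℕ.m≤n⇒∃[o]m+o≡n k≤n = cong (c ℕ.+_) (begin
    (c ℕ.+ d ℕ.+ e ∸ c) ∸ (c ℕ.+ d ℕ.+ e ∸ (c ℕ.+ d))
      ≡⟨ cong₂ _∸_ (trans (cong (_∸ c) (ℕ.+-assoc c d e)) (ℕ.m+n∸m≡n c (d ℕ.+ e)))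
                   (ℕ.m+n∸m≡n (c ℕ.+ d) e) ⟩
    (d ℕ.+ e) ∸ e
      ≡⟨ ℕ.m+n∸n≡m d e ⟩
    d ∎)
  where open ≡-Reasoning

-- Möbius values as signed counts of D-permutations

open FiniteSubset using (size)
open FinitePoset using (μ; χ)

module _ (A : FiniteSubset) (m : ℕ) where
  open FiniteSubset A using (element)

  private
    ∣A∣ = size A
    G = Γ A m
    P = bondLattice G

    maps : List (Vec (Fin ∣A∣) ∣A∣)
    maps = vectors (allFin ∣A∣) ∣A∣

    maps-! : Unique maps
    maps-! = vectors-unique (Unique.allFin⁺ ∣A∣) ∣A∣

    ∣_∣ : Bond G → ℕ
    ∣ π ∣ = numBlocks (value π)

  cycBond : DPermutation A m → Bond G
  cycBond σ@(v , [ p ]) = cyc A m σ , [ cycles-isBond A m {v} p ]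

  -- Every cycle support is a bond, so each D-permutation is counted at exactly one z. With F
  -- restricted to a down-set this serves the Möbius recursion, with F restricted to a fixed number
  -- of blocks the coefficients of χ.
  ∑-support : (F : Table ∣A∣ → ℤ) →
              ∑ (bonds G) (λ z → F (value z) * + numWithSupport A m (value z))
              ≡ ∑ (dPermutations A m) (F ∘ cyc A m)
  ∑-support F = begin
    ∑ (bonds G) (λ z → F (value z) * + numWithSupport A m (value z))
      ≡⟨ ∑-cong (bonds G) (λ z → trans
           (cong (F (value z) *_) (length-filter (λ σ → cyc A m σ ≟ᵀ value z) (dPermutations A m)))
           (*-∑ (F (value z)) _ (dPermutations A m))) ⟩
    ∑ (bonds G) (λ z → ∑ (dPermutations A m) (term z))
      ≡⟨ ∑-swap term (bonds G) (dPermutations A m) ⟩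
    ∑ (dPermutations A m) (λ σ → ∑ (bonds G) (λ z → term z σ))
      ≡⟨ ∑-cong (dPermutations A m) (λ σ → trans
           (∑-single (λ z → term z σ) (FinitePoset.unique P) (FinitePoset.complete P (cycBond σ)) (off σ))
           (trans (cong (F (cyc A m σ) *_) (𝟙-yes (cyc A m σ ≟ᵀ cyc A m σ) refl))
                  (ℤ.*-identityʳ _))) ⟩
    ∑ (dPermutations A m) (F ∘ cyc A m) ∎
    where
    open ≡-Reasoning
    term : Bond G → DPermutation A m → ℤ
    term z σ = F (value z) * 𝟙 (cyc A m σ ≟ᵀ value z)

    off : ∀ σ z → z ≢ cycBond σ → term z σ ≡ 0ℤ
    off σ z z≢ = trans
      (cong (F (value z) *_) (𝟙-no (cyc A m σ ≟ᵀ value z) (λ e → z≢ (bond-≡ G (sym e)))))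
      (ℤ.*-zeroʳ (F (value z)))

  numWithSupport-0̂ : + numWithSupport A m (singletons G) ≡ 1ℤ
  numWithSupport-0̂ = begin
    + numWithSupport A m (singletons G)
      ≡⟨ length-filter (λ σ → cyc A m σ ≟ᵀ singletons G) (dPermutations A m) ⟩
    ∑ (dPermutations A m) (λ σ → 𝟙 (cyc A m σ ≟ᵀ singletons G))
      ≡⟨ ∑-restrict (isDPermutation? A m) (λ v → 𝟙 (cycles v ≟ᵀ singletons G)) maps ⟩
    ∑ maps term
      ≡⟨ ∑-single term maps-! (vectors-complete ∈-allFin ι) off ⟩
    term ι
      ≡⟨ cong₂ _*_ (𝟙-yes (isDPermutation? A m ι) ι-isD) (𝟙-yes (cycles ι ≟ᵀ singletons G) cycles-ι) ⟩
    1ℤ ∎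
    where
    open ≡-Reasoning
    term : Vec (Fin ∣A∣) ∣A∣ → ℤ
    term v = 𝟙 (isDPermutation? A m v) * 𝟙 (cycles v ≟ᵀ singletons G)

    ι : Vec (Fin ∣A∣) ∣A∣
    ι = tabulate id

    lookup-ι : ∀ i → lookup ι i ≡ i
    lookup-ι = Vec.lookup∘tabulate id

    off : ∀ v → v ≢ ι → term v ≡ 0ℤ
    off v v≢ι = trans
      (cong (𝟙 (isDPermutation? A m v) *_) (𝟙-no (cycles v ≟ᵀ singletons G) λ e →
        v≢ι (lookup-ext λ i → trans
          (∈-singletons G (subst (λ τ → lookup v i ∈ lookup τ i) e (∈-cycles⁺ {v = v} (refl ◅ ε))))
          (sym (lookup-ι i)))))
      (ℤ.*-zeroʳ (𝟙 (isDPermutation? A m v)))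

    ι-isD : IsDPermutation A m ι
    ι-isD = ((λ {x} {y} e → trans (sym (lookup-ι x)) (trans e (lookup-ι y)))
            , λ y → y , λ { refl → lookup-ι y })
          , (λ i _ _ → ℕ.≤-reflexive (cong element (sym (lookup-ι i))))
          , (λ i _ → ℕ.≤-reflexive (cong element (lookup-ι i)))

    cycles-ι : cycles ι ≡ singletons G
    cycles-ι = lookup-ext λ i → Subset.⊆-antisym
      (λ {j} j∈ → subst (_∈ lookup (singletons G) i) (sym (stay (∈-cycles⁻ {v = ι} j∈)))
                        (proj₁ (proj₁ (singletons-isBond G)) i))
      (λ {j} j∈ → subst (_∈ lookup (cycles ι) i) (sym (∈-singletons G j∈)) (∈-cycles⁺ {v = ι} ε))
      where
      stay : ∀ {i j} → Star (Step (lookup ι)) i j → j ≡ i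
      stay ε          = refl
      stay {i} (refl ◅ p) = trans (stay p) (lookup-ι i)

  private
    -- The candidate for μ. The factor `sign ∣A∣` normalises it to 1 at `0̂`, where the identity is
    -- the only permutation counted and there are |A| blocks.
    mobius : Bond G → ℤ
    mobius z = sign ∣A∣ * (sign ∣ z ∣ * + numWithSupport A m (value z))

    mobius-0̂ : mobius (0̂ G) ≡ 1ℤ
    mobius-0̂ = trans
      (cong₂ (λ k N → sign ∣A∣ * (sign k * N)) (numBlocks-0̂ G) numWithSupport-0̂)
      (trans (cong (sign ∣A∣ *_) (ℤ.*-identityʳ (sign ∣A∣))) (sign² ∣A∣))

    fullPair : ∀ y → 0̂ G ≢ y → ∃ λ i → FullPair A m (lookup (value y) i)
    fullPair y 0̂≢y with i , j , j∈ , j∉ ← leaving-element G (0̂ G) y (0̂-≤ G y) 0̂≢y =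
      i , connected⇒fullPair A m (proj₂ (bond-isBond G y) i) (proj₁ (bond-isPartition G y) i) j∈
            (λ { refl → j∉ (proj₁ (bond-isPartition G (0̂ G)) i) })

    ∑-mobius : ∀ y → 0̂ G ≢ y → ∑ (bonds G) (λ z → 𝟙 (value z ≤ᵀ? value y) * mobius z) ≡ 0ℤ
    ∑-mobius y 0̂≢y = begin
      ∑ (bonds G) (λ z → 𝟙 (value z ≤ᵀ? value y) * mobius z)
        ≡⟨ ∑-cong (bonds G) (λ z → rearrange (𝟙 (value z ≤ᵀ? value y)) (sign ∣A∣) (sign ∣ z ∣) _) ⟩
      ∑ (bonds G) (λ z → sign ∣A∣ * (F (value z) * + numWithSupport A m (value z)))
        ≡⟨ sym (*-∑ (sign ∣A∣) _ (bonds G)) ⟩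
      sign ∣A∣ * ∑ (bonds G) (λ z → F (value z) * + numWithSupport A m (value z))
        ≡⟨ cong (sign ∣A∣ *_) (∑-support F) ⟩
      sign ∣A∣ * ∑ (dPermutations A m) (F ∘ cyc A m)
        ≡⟨ cong (sign ∣A∣ *_) (∑-restrict (isDPermutation? A m) (F ∘ cycles) maps) ⟩
      sign ∣A∣ * ∑ maps (λ v → 𝟙 (isDPermutation? A m v) * F (cycles v))
        ≡⟨ cong (sign ∣A∣ *_) (trans (∑-cong maps split) (∑-weight≡0 A m y (proj₂ (fullPair y 0̂≢y)))) ⟩
      sign ∣A∣ * 0ℤ
        ≡⟨ ℤ.*-zeroʳ (sign ∣A∣) ⟩
      0ℤ ∎
      where
      open ≡-Reasoning
      F : Table ∣A∣ → ℤ
      F τ = 𝟙 (τ ≤ᵀ? value y) * sign (numBlocks τ)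

      rearrange : ∀ t s k N → t * (s * (k * N)) ≡ s * ((t * k) * N)
      rearrange = solve-∀

      split : ∀ v → 𝟙 (isDPermutation? A m v) * F (cycles v) ≡
                    𝟙 (isDPermutation? A m v ×-dec (cycles v ≤ᵀ? value y)) * sign (numBlocks (cycles v))
      split v = trans (sym (ℤ.*-assoc (𝟙 (isDPermutation? A m v)) _ _))
        (cong (_* sign (numBlocks (cycles v)))
              (sym (𝟙-× (isDPermutation? A m v) (cycles v ≤ᵀ? value y))))

  μ≡mobius : ∀ π → μ P (0̂ G) π ≡ mobius π
  μ≡mobius = μ-unique P (0̂ G) (0̂-≤ G) mobius mobius-0̂ ∑-mobius

  signed-μ : ∀ π → sign ∣ π ∣ * μ P (0̂ G) π ≡ sign ∣A∣ * + numWithSupport A m (value π)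
  signed-μ π = begin
    sign ∣ π ∣ * μ P (0̂ G) π                                  ≡⟨ cong (sign ∣ π ∣ *_) (μ≡mobius π) ⟩
    sign ∣ π ∣ * (sign ∣A∣ * (sign ∣ π ∣ * N))                  ≡⟨ rearrange (sign ∣ π ∣) (sign ∣A∣) N ⟩
    (sign ∣ π ∣ * sign ∣ π ∣) * (sign ∣A∣ * N)                  ≡⟨ cong (_* (sign ∣A∣ * N)) (sign² ∣ π ∣) ⟩
    1ℤ * (sign ∣A∣ * N)                                         ≡⟨ ℤ.*-identityˡ (sign ∣A∣ * N) ⟩
    sign ∣A∣ * N                                                ∎
    where
    open ≡-Reasoning
    N = + numWithSupport A m (value π)
    rearrange : ∀ k s N → k * (s * (k * N)) ≡ (k * k) * (s * N)
    rearrange = solve-∀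

  -- The cycle polynomial and the characteristic polynomial

  s≡∑ : ∀ j → s A m (suc j) ≡
        ∑ (dPermutations A m) (λ σ → 𝟙 (numBlocks (cyc A m σ) ℕ.≟ suc j) * sign (suc j))
  s≡∑ j = begin
    sign (suc j) * + numWithCycles A m (suc j)
      ≡⟨ cong (sign (suc j) *_)
              (length-filter (λ σ → numBlocks (cyc A m σ) ℕ.≟ suc j) (dPermutations A m)) ⟩
    sign (suc j) * ∑ (dPermutations A m) (λ σ → 𝟙 (numBlocks (cyc A m σ) ℕ.≟ suc j))
      ≡⟨ *-∑ (sign (suc j)) _ (dPermutations A m) ⟩
    ∑ (dPermutations A m) (λ σ → sign (suc j) * 𝟙 (numBlocks (cyc A m σ) ℕ.≟ suc j))
      ≡⟨ ∑-cong (dPermutations A m) (λ σ → ℤ.*-comm (sign (suc j)) _) ⟩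
    ∑ (dPermutations A m) (λ σ → 𝟙 (numBlocks (cyc A m σ) ℕ.≟ suc j) * sign (suc j)) ∎
    where open ≡-Reasoning

  -- A cycle support is a bond and so has at most |A| blocks. Equality of polynomials compares all
  -- coefficients, including those past the last summand.
  s-beyond : ∀ {j} → ∣A∣ ≤ j → s A m (suc j) ≡ 0ℤ
  s-beyond {j} n≤j = trans (s≡∑ j) (∑-zero (dPermutations A m) λ σ →
    cong (_* sign (suc j)) (𝟙-no (numBlocks (cyc A m σ) ℕ.≟ suc j) λ e →
      ℕ.<⇒≱ (s≤s n≤j) (subst (_≤ ∣A∣) e (numBlocks≤n G (cycBond σ)))))

  coeff-cyclePolynomial : ∀ j → coeff (cyclePolynomial A m) j ≡ s A m (suc j)
  coeff-cyclePolynomial j = trans (coeff-sumₚ _ (upTo ∣A∣) j)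
    (trans (∑-cong (upTo ∣A∣) λ k → coeff-monomial (s A m (suc k)) k j) (cases (j ℕ.<? ∣A∣)))
    where
    term : ℕ → ℤ
    term k = 𝟙 (k ℕ.≟ j) * s A m (suc k)

    off : ∀ k → k ≢ j → term k ≡ 0ℤ
    off k k≢j = cong (_* s A m (suc k)) (𝟙-no (k ℕ.≟ j) k≢j)

    at-j : term j ≡ s A m (suc j)
    at-j = trans (cong (_* s A m (suc j)) (𝟙-yes (j ℕ.≟ j) refl)) (ℤ.*-identityˡ _)

    cases : Dec (j < ∣A∣) → ∑ (upTo ∣A∣) term ≡ s A m (suc j)
    cases (yes j<n) = trans (∑-single term (Unique.upTo⁺ ∣A∣) (∈-upTo⁺ j<n) off) at-j
    cases (no j≮n)  = trans (∑-zero (upTo ∣A∣) vanish) (sym (s-beyond (ℕ.≮⇒≥ j≮n)))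
      where
      vanish : ∀ k → term k ≡ 0ℤ
      vanish k = split (k ℕ.≟ j)
        where
        split : Dec (k ≡ j) → term k ≡ 0ℤ
        split (no k≢j)   = off k k≢j
        split (yes refl) = trans at-j (s-beyond (ℕ.≮⇒≥ j≮n))

  module _ (1≤n : 1 ≤ ∣A∣) where

    private
      c = numComponents G

      -- Nonemptiness of A enters here and makes c ∸ 1 a true predecessor. For empty A the lattice
      -- is a single point with χ = 1, while the sum over k is empty.
      1≤c : 1 ≤ c
      1≤c = numBlocks>0 (components G) 1≤n

    coeff-term : ∀ j x →
      coeff (shift (c ∸ 1) (monomial (μ P (0̂ G) x) (FinitePoset.len P ∸ FinitePoset.rk P x))) j ≡
      sign ∣A∣ * ((𝟙 (∣ x ∣ ℕ.≟ suc j) * sign (suc j)) * + numWithSupport A m (value x))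
    coeff-term j x = begin
      coeff (shift (c ∸ 1) (monomial (μ P (0̂ G) x) e)) j
        ≡⟨ cong (λ p → coeff p j) (shift-monomial (c ∸ 1) (μ P (0̂ G) x) e) ⟩
      coeff (monomial (μ P (0̂ G) x) ((c ∸ 1) ℕ.+ e)) j
        ≡⟨ coeff-monomial (μ P (0̂ G) x) ((c ∸ 1) ℕ.+ e) j ⟩
      𝟙 ((c ∸ 1) ℕ.+ e ℕ.≟ j) * μ P (0̂ G) x
        -- By `e≡` the shifted exponent is |x| - 1, so x contributes to the coefficient of t^j
        -- precisely when it has j + 1 blocks.
        ≡⟨ cong₂ _*_ (𝟙-cong ((c ∸ 1) ℕ.+ e ℕ.≟ j) (∣ x ∣ ℕ.≟ suc j) to from) (μ≡mobius x) ⟩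
      𝟙 (∣ x ∣ ℕ.≟ suc j) * mobius x
        ≡⟨ cases (∣ x ∣ ℕ.≟ suc j) ⟩
      sign ∣A∣ * ((𝟙 (∣ x ∣ ℕ.≟ suc j) * sign (suc j)) * N) ∎
      where
      open ≡-Reasoning
      N = + numWithSupport A m (value x)
      e = FinitePoset.len P ∸ FinitePoset.rk P x

      e≡ : (c ∸ 1) ℕ.+ e ≡ ∣ x ∣ ∸ 1
      e≡ = trans (cong₂ (λ l r → (c ∸ 1) ℕ.+ (l ∸ r)) (len≡ G) (rk≡ G x))
                 (corank-exponent 1≤c (numComponents≤ G x) (numBlocks≤n G x))

      suc-pred : suc (∣ x ∣ ∸ 1) ≡ ∣ x ∣
      suc-pred = ℕ.m+[n∸m]≡n (ℕ.≤-trans 1≤c (numComponents≤ G x))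

      to : (c ∸ 1) ℕ.+ e ≡ j → ∣ x ∣ ≡ suc j
      to e≡j = trans (sym suc-pred) (cong suc (trans (sym e≡) e≡j))

      from : ∣ x ∣ ≡ suc j → (c ∸ 1) ℕ.+ e ≡ j
      from x≡ = trans e≡ (cong (_∸ 1) x≡)

      cases : (d : Dec (∣ x ∣ ≡ suc j)) → 𝟙 d * mobius x ≡ sign ∣A∣ * ((𝟙 d * sign (suc j)) * N)
      cases (yes x≡) = trans (cong (λ k → 1ℤ * (sign ∣A∣ * (sign k * N))) x≡)
                             (rearrange (sign ∣A∣) (sign (suc j)) N)
        where
        rearrange : ∀ s k N → 1ℤ * (s * (k * N)) ≡ s * ((1ℤ * k) * N)
        rearrange = solve-∀
      cases (no _) = sym (ℤ.*-zeroʳ (sign ∣A∣))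

    χ≈cyclePolynomial : shift (c ∸ 1) (χ P (0̂ G)) ≈ₚ sign ∣A∣ ·ₚ cyclePolynomial A m
    χ≈cyclePolynomial j = begin
      coeff (shift (c ∸ 1) (χ P (0̂ G))) j
        ≡⟨ coeff-shift-sumₚ _ (c ∸ 1) (bonds G) j ⟩
      ∑ (bonds G) (λ x → coeff (shift (c ∸ 1)
        (monomial (μ P (0̂ G) x) (FinitePoset.len P ∸ FinitePoset.rk P x))) j)
        ≡⟨ ∑-cong (bonds G) (coeff-term j) ⟩
      ∑ (bonds G) (λ x → sign ∣A∣ * (F (value x) * + numWithSupport A m (value x)))
        ≡⟨ sym (*-∑ (sign ∣A∣) _ (bonds G)) ⟩
      sign ∣A∣ * ∑ (bonds G) (λ x → F (value x) * + numWithSupport A m (value x))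
        ≡⟨ cong (sign ∣A∣ *_) (trans (∑-support F) (sym (s≡∑ j))) ⟩
      sign ∣A∣ * s A m (suc j)
        ≡⟨ cong (sign ∣A∣ *_) (sym (coeff-cyclePolynomial j)) ⟩
      sign ∣A∣ * coeff (cyclePolynomial A m) j
        ≡⟨ sym (coeff-·ₚ (sign ∣A∣) (cyclePolynomial A m) j) ⟩
      coeff (sign ∣A∣ ·ₚ cyclePolynomial A m) j ∎
      where
      open ≡-Reasoning
      F : Table ∣A∣ → ℤ
      F τ = 𝟙 (numBlocks τ ℕ.≟ suc j) * sign (suc j)

theorem1p2 : (A : FiniteSubset) (m : ℕ) → 1 ≤ m → Odd m →
    ((π : Bond (Γ A m)) →
    sign (numBlocks (value π)) * μ (bondLattice (Γ A m)) (0̂ (Γ A m)) π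
    ≡ sign (size A) * (+ numWithSupport A m (value π)))
    ×
    (1 ≤ size A →
    shift (numComponents (Γ A m) ∸ 1) (χ (bondLattice (Γ A m)) (0̂ (Γ A m)))
    ≈ₚ sign (size A) ·ₚ cyclePolynomial A m)
theorem1p2 A m _ _ = signed-μ A m , χ≈cyclePolynomial A m
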